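{- Let $M$ be a balanced and aligned marking for a permutation $\pi\in S_n$. Then $\pi$ has a perfect tangle whose corresponding marking is $M$.
   Context: Tangles: $S_n$ is the set of permutations of $\{1,\dots,n\}$, $\pi(p)$ the element at position $p$; $\pi=[\dots a\dots b\dots]$ means $a$ occurs before $b$, and $\pi=[\dots ab\dots]$ means $b$ occurs immediately after $a$. The swap $\sigma(i)$ exchanges the elements at positions $i,i+1$. Two permutations are adjacent if one is obtained from the other by swaps $\sigma(p_1),\dots,\sigma(p_k)$ ($k\ge0$) with pairwise $|p_i-p_j|\ge2$. A tangle is a finite sequence $\pi_0,\dots,\pi_m$ with consecutive permutations adjacent; it solves $\pi$ if $\pi_0=\pi$ and $\pi_m$ is the identity (by convention $\pi_0=\pi_1$, $\pi_{m-1}=\pi_m$). In the drawing, element $x$ at time $t$ is at $(p,-t)$ where $\pi_t(p)=x$, and path $x$ is the polyline through these points. A segment is a maximal straight piece of a path; a non-vertical segment is an L-segment if, traversed downward, it moves left, and an R-segment if it moves right. A tangle solving $\pi$ is simple if no two paths cross more than once, and perfect if it is simple and each path has at most one L-segment and at most one R-segment. The marking corresponding to a tangle assigns to each $i$ the string obtained by tracing path $i$ from top to bottom and appending $L$ for each L-segment and $R$ for each R-segment met (vertical segments ignored). Markings: an inversion of $\pi$ is a pair $(a,b)$ with $a>b$ and $\pi=[\dots a\dots b\dots]$. Element $i$ is right if in some inversion $(i,j)$, left if in some inversion $(j,i)$; left-straight if left but not right; right-straight if right but not left; a switchback if both. A marking $M$ (function from $\{1,\dots,n\}$ to strings in $L,R$)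 is a marking for $\pi$ if $M(i)=L$ for left-straight $i$, $M(i)=R$ for right-straight $i$, $M(i)\in\{LR,RL\}$ for switchbacks, and $M(i)=\emptyset$ otherwise. A quadruple $(a,b,c,d)$ is a rec in $\pi$ if $\pi=[\dots a\dots b\dots c\dots d\dots]$ and $\min\{a,b\}>\max\{c,d\}$. Under $M$, $e$ is a left switchback of the rec if $M(e)=RL$, $\pi=[\dots a\dots e\dots b\dots]$, and $e$ is strictly between $c$ and $d$ in value; a right switchback if $M(e)=LR$, $\pi=[\dots c\dots e\dots d\dots]$, and $e$ is strictly between $a$ and $b$ in value. The rec is regular if $a<b$ and $c<d$, irregular otherwise; balanced if it has equally many left and right switchbacks; empty if it has none. $M$ is balanced if every regular rec is balanced and every irregular rec is empty under $M$. $M$ is aligned with $\pi$ if for every pair $a,b$ with $\pi=[\dots ab\dots]$, $M(a)$ starting with $R$ and $M(b)$ starting with $L$, the pair $(a,b)$ is an inversion. -}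

module Defs where

open import Data.Nat as ℕ using (ℕ; zero; suc; _<_; _≤_; _<ᵇ_; _+_; _∸_)
open import Data.Fin as Fin using (Fin; toℕ)
open import Data.Fin.Properties as FinP using ()
open import Data.Vec as Vec using (Vec; []; _∷_; lookup)
open import Data.List as List using (List; []; _∷_; _++_; length; filter; upTo; map)
open import Data.List.Relation.Unary.All using (All)
open import Data.List.Relation.Unary.AllPairs using (AllPairs)
open import Data.List.Properties as ListP using ()
open import Data.Maybe using (Maybe; just; nothing)
open import Data.Bool using (Bool; true; false; if_then_else_; _xor_)
open import Data.Product using (Σ; ∃; _×_; _,_)
open import Data.Sum using (_⊎_)
open import Relation.Nullary using (¬_; Dec; yes; no)
open import Relation.Nullary.Decidable using (_×-dec_; _⊎-dec_; does)
open import Relation.Unary using (Decidable)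
open import Relation.Binary.PropositionalEquality using (_≡_; refl)

-- Permutations.  Elements {1,…,n} are represented by Fin n = {0,…,n-1}
-- (order-preserving relabelling).  A permutation is the vector of its
-- elements listed by position:  lookup π p = π(p).

Perm : ℕ → Set
Perm n = Vec (Fin n) n

IsPerm : ∀ {n} → Perm n → Set
IsPerm {n} π = (i j : Fin n) → lookup π i ≡ lookup π j → i ≡ j

identity : ∀ n → Perm n
identity n = Vec.allFin n

pos : ∀ {n k} → Vec (Fin n) k → Fin n → ℕ
pos [] x = 0
pos (y ∷ ys) x = if does (y Fin.≟ x) then 0 else suc (pos ys x)

Before : ∀ {n} → Perm n → Fin n → Fin n → Set
Before π a b = pos π a < pos π b

ImmBefore : ∀ {n} → Perm n → Fin n → Fin n → Set
ImmBefore π a b = pos π b ≡ suc (pos π a)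

swapAt : ∀ {A : Set} {k} → ℕ → Vec A k → Vec A k
swapAt zero (x ∷ y ∷ xs) = y ∷ x ∷ xs
swapAt (suc i) (x ∷ xs) = x ∷ swapAt i xs
swapAt _ xs = xs

FarApart : ℕ → ℕ → Set
FarApart p q = suc p < q ⊎ suc q < p

Adjacent : ∀ {n} → Perm n → Perm n → Set
Adjacent {n} π π' =
  Σ (List ℕ) λ ps →
    All (λ p → suc p < n) ps ×
    AllPairs FarApart ps ×
    π' ≡ List.foldr swapAt π ps

-- Two permutations are adjacent if one is obtained from the other by such
-- swaps (the relation is symmetric since disjoint swaps are involutive).
AdjacentPerms : ∀ {n} → Perm n → Perm n → Set
AdjacentPerms π π' = Adjacent π π' ⊎ Adjacent π' π

-- Tangles.  A tangle π₀,…,π_m is given by m and T : ℕ → Perm n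
-- (only T 0, …, T m matter).

record Tangle (n : ℕ) : Set where
  constructor tangle
  field
    len  : ℕ
    perm : ℕ → Perm n
open Tangle public

IsTangle : ∀ {n} → Tangle n → Set
IsTangle τ = (t : ℕ) → t < len τ → AdjacentPerms (perm τ t) (perm τ (suc t))

Solves : ∀ {n} → Tangle n → Perm n → Set
Solves {n} τ π =
  IsTangle τ ×
  1 ≤ len τ ×
  perm τ 0 ≡ π ×
  perm τ (len τ) ≡ identity n ×
  perm τ 0 ≡ perm τ 1 ×
  perm τ (len τ ∸ 1) ≡ perm τ (len τ)

-- Drawing: element x at time t is at (pos (π_t) x, -t).  Each step of the
-- path of x moves left, right or is vertical.

data Dir : Set where
  left right vert : Dir

dir : ℕ → ℕ → Dir
dir p q = if q <ᵇ p then left else (if p <ᵇ q then right else vert)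

sameDir : Dir → Dir → Bool
sameDir left left = true
sameDir right right = true
sameDir vert vert = true
sameDir _ _ = false

steps : ∀ {n} → Tangle n → Fin n → List Dir
steps τ x = map (λ t → dir (pos (perm τ t) x) (pos (perm τ (suc t)) x)) (upTo (len τ))

data LR : Set where
  L R : LR

_≟LR_ : (a b : LR) → Dec (a ≡ b)
L ≟LR L = yes refl
R ≟LR R = yes refl
L ≟LR R = no λ ()
R ≟LR L = no λ ()

symbol : Dir → List LR
symbol left = L ∷ []
symbol right = R ∷ []
symbol vert = []

-- A segment is a maximal run of equal step directions; emit a symbol at the
-- start of each non-vertical segment.
segments : Maybe Dir → List Dir → List LR
segments prev [] = []
segments nothing (d ∷ ds) = symbol d ++ segments (just d) ds
segments (just p) (d ∷ ds) =
  (if sameDir p d then [] else symbol d) ++ segments (just d) ds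

tangleMarking : ∀ {n} → Tangle n → Fin n → List LR
tangleMarking τ x = segments nothing (steps τ x)

crossings : ∀ {n} → Tangle n → Fin n → Fin n → ℕ
crossings τ x y = length (List.filterᵇ flips (upTo (len τ)))
  where
  flips : ℕ → Bool
  flips t = (pos (perm τ t) x <ᵇ pos (perm τ t) y)
            xor (pos (perm τ (suc t)) x <ᵇ pos (perm τ (suc t)) y)

countLR : LR → List LR → ℕ
countLR c xs = length (filter (_≟LR c) xs)

Simple : ∀ {n} → Tangle n → Set
Simple {n} τ = (x y : Fin n) → crossings τ x y ≤ 1

Perfect : ∀ {n} → Tangle n → Set
Perfect {n} τ =
  Simple τ ×
  ((x : Fin n) → countLR L (tangleMarking τ x) ≤ 1 × countLR R (tangleMarking τ x) ≤ 1)

Marking : ℕ → Set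
Marking n = Fin n → List LR

Inversion : ∀ {n} → Perm n → Fin n → Fin n → Set
Inversion π a b = b Fin.< a × Before π a b

IsRight : ∀ {n} → Perm n → Fin n → Set
IsRight π i = ∃ λ j → Inversion π i j

IsLeft : ∀ {n} → Perm n → Fin n → Set
IsLeft π i = ∃ λ j → Inversion π j i

IsMarkingFor : ∀ {n} → Perm n → Marking n → Set
IsMarkingFor {n} π M = (i : Fin n) →
  (IsLeft π i → ¬ IsRight π i → M i ≡ L ∷ []) ×
  (IsRight π i → ¬ IsLeft π i → M i ≡ R ∷ []) ×
  (IsLeft π i → IsRight π i → M i ≡ L ∷ R ∷ [] ⊎ M i ≡ R ∷ L ∷ []) ×
  (¬ IsLeft π i → ¬ IsRight π i → M i ≡ [])

IsRec : ∀ {n} → Perm n → Fin n → Fin n → Fin n → Fin n → Set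
IsRec π a b c d =
  Before π a b × Before π b c × Before π c d ×
  c Fin.< a × c Fin.< b × d Fin.< a × d Fin.< b

Between : ∀ {n} → Fin n → Fin n → Fin n → Set
Between x e y = (x Fin.< e × e Fin.< y) ⊎ (y Fin.< e × e Fin.< x)

LeftSwitchback : ∀ {n} → Perm n → Marking n → Fin n → Fin n → Fin n → Fin n → Fin n → Set
LeftSwitchback π M a b c d e =
  M e ≡ R ∷ L ∷ [] × Before π a e × Before π e b × Between c e d

RightSwitchback : ∀ {n} → Perm n → Marking n → Fin n → Fin n → Fin n → Fin n → Fin n → Set
RightSwitchback π M a b c d e =
  M e ≡ L ∷ R ∷ [] × Before π c e × Before π e d × Between a e b

private
  between? : ∀ {n} (x e y : Fin n) → Dec (Between x e y)
  between? x e y = ((x Fin.<? e) ×-dec (e Fin.<? y)) ⊎-dec ((y Fin.<? e) ×-dec (e Fin.<? x))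

  before? : ∀ {n} (π : Perm n) a b → Dec (Before π a b)
  before? π a b = pos π a ℕ.<? pos π b

  lr? : (xs ys : List LR) → Dec (xs ≡ ys)
  lr? = ListP.≡-dec _≟LR_

leftSwitchback? : ∀ {n} π M (a b c d : Fin n) → Decidable (LeftSwitchback π M a b c d)
leftSwitchback? π M a b c d e =
  lr? (M e) (R ∷ L ∷ []) ×-dec before? π a e ×-dec before? π e b ×-dec between? c e d

rightSwitchback? : ∀ {n} π M (a b c d : Fin n) → Decidable (RightSwitchback π M a b c d)
rightSwitchback? π M a b c d e =
  lr? (M e) (L ∷ R ∷ []) ×-dec before? π c e ×-dec before? π e d ×-dec between? a e b

countFin : ∀ {n} {P : Fin n → Set} → Decidable P → ℕ
countFin {n} P? = length (filter P? (List.allFin n))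

IsRegular : ∀ {n} → Fin n → Fin n → Fin n → Fin n → Set
IsRegular a b c d = a Fin.< b × c Fin.< d

RecBalanced : ∀ {n} → Perm n → Marking n → Fin n → Fin n → Fin n → Fin n → Set
RecBalanced π M a b c d =
  countFin (leftSwitchback? π M a b c d) ≡ countFin (rightSwitchback? π M a b c d)

RecEmpty : ∀ {n} → Perm n → Marking n → Fin n → Fin n → Fin n → Fin n → Set
RecEmpty {n} π M a b c d =
  (e : Fin n) → ¬ LeftSwitchback π M a b c d e × ¬ RightSwitchback π M a b c d e

BalancedMarking : ∀ {n} → Perm n → Marking n → Set
BalancedMarking {n} π M = (a b c d : Fin n) → IsRec π a b c d →
  (IsRegular a b c d → RecBalanced π M a b c d) ×
  (¬ IsRegular a b c d → RecEmpty π M a b c d)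

AlignedMarking : ∀ {n} → Perm n → Marking n → Set
AlignedMarking {n} π M = (a b : Fin n) → ImmBefore π a b →
  List.head (M a) ≡ just R → List.head (M b) ≡ just L → Inversion π a b

{-# OPTIONS --safe #-}

-- Give every inversion (a , b) a crossing time.  The marking fixes the order in which a
-- right-moving element crosses the smaller elements after it; let r(a , b) be the rank of
-- b in this order and s(a , b) the mirror-image rank of a among the elements that b crosses
-- on its way left.  A perfect tangle must have times r(a , b) + α(a) = s(a , b) + β(b), so
-- r - s has to be additively separable on the bipartite graph of inversions.  Balance says
-- that the alternating sum of r - s over the four inversions of a rec vanishes,
-- and these four-cycles suffice: placing the elements from left to right, any two
-- constraints on a new element share an inversion with all elements concerned.  Alignment
-- makes the two orders transitive.  The crossing times of a triple are then ordered as in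
-- a reduced word, so swapping at time t all pairs with crossing time t is legal, and the
-- crossing times along one segment are consecutive, so no segment pauses.

module Submission where

open import Defs
open import Data.Bool using (Bool; true; false; not; T; _xor_; if_then_else_)
open import Data.Bool.Properties using (T-≡)
open import Data.Empty using (⊥; ⊥-elim)
open import Data.Fin as Fin using (Fin; zero; suc; toℕ; fromℕ<; punchOut)
import Data.Fin.Properties as Finₚ
open import Data.List as List using (List; []; _∷_; length; filter; filterᵇ; allFin; upTo; applyUpTo)
open import Data.List.Membership.Propositional using (_∈_)
open import Data.List.Membership.Propositional.Properties using (∈-map⁺; ∈-filter⁺; ∈-allFin)
import Data.List.Properties as Listₚ
open import Data.List.Relation.Unary.All as All using (All; []; _∷_)
import Data.List.Relation.Unary.All.Properties as Allₚ
open import Data.List.Relation.Unary.AllPairs using (AllPairs; []; _∷_)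
import Data.List.Relation.Unary.AllPairs.Properties as AllPairsₚ
open import Data.List.Relation.Unary.Any using (here; there)
open import Data.List.Relation.Unary.Unique.Propositional.Properties using (allFin⁺; upTo⁺)
open import Data.Maybe using (just; nothing)
open import Data.Nat as ℕ using (ℕ; zero; suc; _+_; _≤_; _<_; _⊔_)
import Data.Nat.Properties as ℕₚ
open import Data.Nat.Tactic.RingSolver using (solve-∀)
open import Data.Product using (Σ; ∃; ∃₂; _×_; _,_; proj₁; proj₂)
open import Data.Sum using (_⊎_; inj₁; inj₂)
open import Data.Vec using (Vec; []; _∷_; lookup)
import Data.Vec.Properties as Vecₚ
open import Function using (_∘_; id; flip; Equivalence)
open import Relation.Binary using (Trichotomous; Transitive; tri<; tri≈; tri>)
import Relation.Binary.Construct.Flip.EqAndOrd as Flip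
open import Relation.Binary.PropositionalEquality
open import Relation.Nullary using (¬_; Dec; yes; no; does)
open import Relation.Nullary.Decidable using (_×-dec_; ¬?; map′; dec-true; dec-false; T?)
open import Relation.Unary using (Decidable)
open import Algebra.Properties.CommutativeMonoid.Sum ℕₚ.+-0-commutativeMonoid
  using (sum; sum-cong-≗; ∑-distrib-+)

-- A rightward segment of `a` makes one crossing per unit of time and never pauses, so its crossing
-- times are its starting time plus r; likewise s counts from the start of the leftward segment of
-- `b`. Thus α and β are these starting times, up to a constant, and the difficulty is that each
-- inversion is timed by both of its elements. Only α is constructed: β is eliminated by asking that
-- r + α - s depend on `b` alone, and subtracted terms are moved across so that all equations stay
-- in ℕ. Balance makes the alternating sums of r and of s vanish separately. For a rec (a, b, c, d),
-- the difference of r(a, d) and r(a, c) is a signed count of the elements that `a` crosses between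
-- `c` and `d`. In comparing it with the same difference for `b`, elements crossed by both cancel;
-- in a regular rec those crossed by only one of them are the left and the right switchbacks.
-- Reflection gives the statement for s.

private variable
  n k : ℕ

-- Counting

indicator : {A : Set} → Dec A → ℕ
indicator d = if does d then 1 else 0

indicator-cong : {A B : Set} (d : Dec A) (e : Dec B) → (A → B) → (B → A) → indicator d ≡ indicator e
indicator-cong (yes a) (yes b) f g = refl
indicator-cong (yes a) (no ¬b) f g = ⊥-elim (¬b (f a))
indicator-cong (no ¬a) (yes b) f g = ⊥-elim (¬a (g b))
indicator-cong (no ¬a) (no ¬b) f g = refl

length-filter-tabulate : {A : Set} {P : A → Set} (P? : Decidable P) (f : Fin n → A) →
  List.length (filter P? (List.tabulate f)) ≡ sum (λ i → indicator (P? (f i)))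
length-filter-tabulate {zero} P? f = refl
length-filter-tabulate {suc n} P? f with does (P? (f zero))
... | true = cong suc (length-filter-tabulate P? (f ∘ suc))
... | false = length-filter-tabulate P? (f ∘ suc)

countFin≡sum : {P : Fin n → Set} (P? : Decidable P) → countFin P? ≡ sum (λ i → indicator (P? i))
countFin≡sum P? = length-filter-tabulate P? id

countFin-cong : {P Q : Fin n → Set} (P? : Decidable P) (Q? : Decidable Q) →
  (∀ i → P i → Q i) → (∀ i → Q i → P i) → countFin P? ≡ countFin Q?
countFin-cong P? Q? f g = trans (countFin≡sum P?)
  (trans (sum-cong-≗ (λ i → indicator-cong (P? i) (Q? i) (f i) (g i))) (sym (countFin≡sum Q?)))

sum-mono-≤ : (f g : Fin n → ℕ) → (∀ i → f i ≤ g i) → sum f ≤ sum g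
sum-mono-≤ {zero} f g h = ℕ.z≤n
sum-mono-≤ {suc n} f g h = ℕₚ.+-mono-≤ (h zero) (sum-mono-≤ (f ∘ suc) (g ∘ suc) (h ∘ suc))

sum-0 : (f : Fin n → ℕ) → (∀ i → f i ≡ 0) → sum f ≡ 0
sum-0 {zero} f h = refl
sum-0 {suc n} f h = cong₂ _+_ (h zero) (sum-0 (f ∘ suc) (h ∘ suc))

sum-indicator-≟ : (e : Fin n) → sum (λ i → indicator (i Fin.≟ e)) ≡ 1
sum-indicator-≟ {suc n} zero = cong suc (sum-0 {n} (λ i → indicator (suc i Fin.≟ zero)) (λ i → refl))
sum-indicator-≟ (suc e) = trans (sum-cong-≗ (λ i → indicator-cong (suc i Fin.≟ suc e) (i Fin.≟ e)
  Finₚ.suc-injective (cong suc))) (sum-indicator-≟ e)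

module _ {P Q : Fin n → Set} (P? : Decidable P) (Q? : Decidable Q) (e : Fin n) (¬Pe : ¬ P e) where

  private
    with-e : sum (λ i → indicator (P? i) + indicator (i Fin.≟ e)) ≡ suc (countFin P?)
    with-e = trans (∑-distrib-+ (λ i → indicator (P? i)) (λ i → indicator (i Fin.≟ e)))
      (trans (cong₂ _+_ (sym (countFin≡sum P?)) (sum-indicator-≟ e)) (ℕₚ.+-comm (countFin P?) 1))

  countFin-insert : (∀ i → P i → Q i) → Q e → (∀ i → Q i → P i ⊎ i ≡ e) →
    countFin Q? ≡ suc (countFin P?)
  countFin-insert P⊆Q Qe Q⊆ = trans (countFin≡sum Q?) (trans (sum-cong-≗ pointwise) with-e)
    where
    pointwise : ∀ i → indicator (Q? i) ≡ indicator (P? i) + indicator (i Fin.≟ e)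
    pointwise i with Q? i | P? i | i Fin.≟ e
    ... | yes q | yes p | yes refl = ⊥-elim (¬Pe p)
    ... | yes q | yes p | no _ = refl
    ... | yes q | no ¬p | yes _ = refl
    ... | yes q | no ¬p | no i≢e with Q⊆ i q
    ...   | inj₁ p = ⊥-elim (¬p p)
    ...   | inj₂ i≡e = ⊥-elim (i≢e i≡e)
    pointwise i | no ¬q | yes p | _ = ⊥-elim (¬q (P⊆Q i p))
    pointwise i | no ¬q | no ¬p | yes refl = ⊥-elim (¬q Qe)
    pointwise i | no ¬q | no ¬p | no _ = refl

  countFin-mono-< : (∀ i → P i → Q i) → Q e → countFin P? ℕ.< countFin Q?
  countFin-mono-< P⊆Q Qe = subst₂ _≤_ with-e (sym (countFin≡sum Q?)) (sum-mono-≤ _ _ pointwise)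
    where
    pointwise : ∀ i → indicator (P? i) + indicator (i Fin.≟ e) ≤ indicator (Q? i)
    pointwise i with Q? i | P? i | i Fin.≟ e
    ... | yes q | yes p | yes refl = ⊥-elim (¬Pe p)
    ... | yes q | yes p | no _ = ℕₚ.≤-refl
    ... | yes q | no ¬p | yes _ = ℕₚ.≤-refl
    ... | yes q | no ¬p | no _ = ℕ.z≤n
    ... | no ¬q | yes p | _ = ⊥-elim (¬q (P⊆Q i p))
    ... | no ¬q | no ¬p | yes refl = ⊥-elim (¬q Qe)
    ... | no ¬q | no ¬p | no _ = ℕ.z≤n

-- Read `A`, `B` as "`a`, `b` cross `e`" and `D`, `C` as "`e` precedes `d`, `c` in the crossing
-- order". Of the sixteen rows exactly two violate the identity, and the two hypotheses exclude
-- them.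
exchange-indicators : {A B C D : Set} (A? : Dec A) (B? : Dec B) (D? : Dec D) (C? : Dec C) →
  (A → ¬ B → ¬ D → ¬ C) → (¬ A → B → ¬ D → ¬ C) →
  (indicator (A? ×-dec D?) + indicator (B? ×-dec C?)) + indicator ((¬? A? ×-dec B?) ×-dec (D? ×-dec ¬? C?))
  ≡ (indicator (B? ×-dec D?) + indicator (A? ×-dec C?)) + indicator ((A? ×-dec ¬? B?) ×-dec (D? ×-dec ¬? C?))
exchange-indicators (no _) (no _) _ _ h k = refl
exchange-indicators (yes _) (yes _) (yes _) (yes _) h k = refl
exchange-indicators (yes _) (yes _) (yes _) (no _) h k = refl
exchange-indicators (yes _) (yes _) (no _) (yes _) h k = refl
exchange-indicators (yes _) (yes _) (no _) (no _) h k = refl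
exchange-indicators (yes _) (no _) (yes _) (yes _) h k = refl
exchange-indicators (yes _) (no _) (yes _) (no _) h k = refl
exchange-indicators (yes a) (no b) (no d) (yes c) h k = ⊥-elim (h a b d c)
exchange-indicators (yes _) (no _) (no _) (no _) h k = refl
exchange-indicators (no _) (yes _) (yes _) (yes _) h k = refl
exchange-indicators (no _) (yes _) (yes _) (no _) h k = refl
exchange-indicators (no a) (yes b) (no d) (yes c) h k = ⊥-elim (k a b d c)
exchange-indicators (no _) (yes _) (no _) (no _) h k = refl

-- Crossing orders and their ranks

module StrictOrder {A : Set} {_◂_ : A → A → Set} (cmp : Trichotomous _≡_ _◂_) where

  asym : ∀ {x y} → x ◂ y → ¬ (y ◂ x)
  asym {x} {y} p q with cmp x y
  ... | tri< _ _ ¬q = ¬q q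
  ... | tri≈ ¬p _ _ = ¬p p
  ... | tri> ¬p _ _ = ¬p p

  irrefl : ∀ {x} → ¬ (x ◂ x)
  irrefl p = asym p p

  dec : ∀ x y → Dec (x ◂ y)
  dec x y with cmp x y
  ... | tri< p _ _ = yes p
  ... | tri≈ ¬p _ _ = no ¬p
  ... | tri> ¬p _ _ = no ¬p

-- x ◁ y: x occurs before y; x < y: x is smaller than y; rl x: x turns from
-- right to left if it is a switchback.  Reversing both orders and negating rl
-- is the reflection of a drawing in a vertical line.
module Crossings {n : ℕ} {_◁_ _<_ : Fin n → Fin n → Set}
  (◁-trans : Transitive _◁_) (◁-cmp : Trichotomous _≡_ _◁_)
  (<-trans : Transitive _<_) (<-cmp : Trichotomous _≡_ _<_)
  (rl : Fin n → Bool) where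

  module ◁ = StrictOrder ◁-cmp
  module < = StrictOrder <-cmp

  Inv : Fin n → Fin n → Set
  Inv a b = b < a × a ◁ b

  inv? : ∀ a b → Dec (Inv a b)
  inv? a b = <.dec b a ×-dec ◁.dec a b

  -- The order in which a right-moving element crosses e and f: by position,
  -- except that an inverted pair has been reversed by then if the first element is RL.
  data _≺_ (e f : Fin n) : Set where
    rising   : e ◁ f → e < f → e ≺ f
    left-right : e ◁ f → f < e → rl e ≡ false → e ≺ f
    right-left : f ◁ e → e < f → rl f ≡ true → e ≺ f

  ≺-asym : ∀ {e f} → e ≺ f → ¬ (f ≺ e)
  ≺-asym (rising p q) (rising p' q') = ◁.asym p p'
  ≺-asym (rising p q) (left-right p' q' r') = ◁.asym p p'
  ≺-asym (rising p q) (right-left p' q' r') = <.asym q q'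
  ≺-asym (left-right p q r) (rising p' q') = ◁.asym p p'
  ≺-asym (left-right p q r) (left-right p' q' r') = ◁.asym p p'
  ≺-asym (left-right p q r) (right-left p' q' r') with () ← trans (sym r) r'
  ≺-asym (right-left p q r) (rising p' q') = <.asym q q'
  ≺-asym (right-left p q r) (left-right p' q' r') with () ← trans (sym r) r'
  ≺-asym (right-left p q r) (right-left p' q' r') = ◁.asym p p'

  ≺-irrefl : ∀ {e} → ¬ (e ≺ e)
  ≺-irrefl p = ≺-asym p p

  ≺-cmp : Trichotomous _≡_ _≺_
  ≺-cmp e f = decide (◁-cmp e f) (<-cmp e f)
    where
    lt : e ≺ f → _
    lt p = tri< p (λ { refl → ≺-irrefl p }) (≺-asym p)
    gt : f ≺ e → _
    gt p = tri> (≺-asym p) (λ { refl → ≺-irrefl p }) p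
    decide : _ → _ → _
    decide (tri≈ _ refl _) _ = tri≈ ≺-irrefl refl ≺-irrefl
    decide (tri< p e≢f _) (tri≈ _ e≡f _) = ⊥-elim (e≢f e≡f)
    decide (tri< p _ _) (tri< q _ _) = lt (rising p q)
    decide (tri< p _ _) (tri> _ _ q) with rl e in r
    ... | true = gt (right-left p q r)
    ... | false = lt (left-right p q r)
    decide (tri> _ e≢f p) (tri≈ _ e≡f _) = ⊥-elim (e≢f e≡f)
    decide (tri> _ _ p) (tri> _ _ q) = gt (rising p q)
    decide (tri> _ _ p) (tri< q _ _) with rl f in r
    ... | true = lt (right-left p q r)
    ... | false = gt (left-right p q r)

  module ≺ = StrictOrder ≺-cmp

  crossedBefore? : ∀ a b → Decidable (λ e → Inv a e × e ≺ b)
  crossedBefore? a b e = inv? a e ×-dec ≺.dec e b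

  rank : Fin n → Fin n → ℕ
  rank a b = countFin (crossedBefore? a b)

  Rec : Fin n → Fin n → Fin n → Fin n → Set
  Rec a b c d = a ◁ b × b ◁ c × c ◁ d × c < a × c < b × d < a × d < b

  StrictlyBetween : Fin n → Fin n → Fin n → Set
  StrictlyBetween x e y = (x < e × e < y) ⊎ (y < e × e < x)

  LeftSB RightSB : Fin n → Fin n → Fin n → Fin n → Fin n → Set
  LeftSB a b c d e = rl e ≡ true × a ◁ e × e ◁ b × StrictlyBetween c e d
  RightSB a b c d e = rl e ≡ false × c ◁ e × e ◁ d × StrictlyBetween a e b

  -- `countFin` takes a decider as argument. Leaving the deciders arbitrary allows ones obtained by
  -- transport, from `onlyA?` and `onlyB?` or across the reflection.
  Balanced : Set
  Balanced = ∀ a b c d → Rec a b c d →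
    (a < b × c < d → (P? : Decidable (LeftSB a b c d)) (Q? : Decidable (RightSB a b c d)) →
      countFin P? ≡ countFin Q?) ×
    (¬ (a < b × c < d) → ∀ e → ¬ LeftSB a b c d e × ¬ RightSB a b c d e)

  -- Among the elements crossed by `d` this configuration is a cycle `a ≺ b`, `b ≺ c`, `c ≺ a`, by
  -- `rising`, `left-right` and `right-left` in turn.
  Unobstructed : Set
  Unobstructed = ∀ {d a b c} → d ◁ a → a ◁ b → b ◁ c → c < a → a < b → b < d →
    rl a ≡ true → rl b ≡ false → ⊥

  module _ (unobstructed : Unobstructed) where

    -- Where transitivity of the two underlying orders does not suffice, a three-cycle remains. It
    -- is either contradictory in itself or the configuration of `Unobstructed`, whose `d` is the
    -- common right mover.
    ≺-trans : ∀ {a e f g} → Inv a e → Inv a f → Inv a g → e ≺ f → f ≺ g → e ≺ g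
    ≺-trans {a} {e} {f} {g} (ea , ae) (fa , af) (ga , ag) = go
      where
      go : e ≺ f → f ≺ g → e ≺ g
      go (rising p q) (rising p' q') = rising (◁-trans p p') (<-trans q q')
      go (rising p q) (left-right p' q' r') with ≺-cmp e g
      ... | tri< x _ _ = x
      ... | tri≈ _ refl _ = ⊥-elim (◁.asym p p')
      ... | tri> _ _ (rising x _) = ⊥-elim (◁.asym x (◁-trans p p'))
      ... | tri> _ _ (left-right x _ _) = ⊥-elim (◁.asym x (◁-trans p p'))
      ... | tri> _ _ (right-left x y r) = ⊥-elim (unobstructed ae p p' y q fa r r')
      go (rising p q) (right-left p' q' r') with ◁-cmp e g
      ... | tri< x _ _ = rising x (<-trans q q')
      ... | tri≈ _ refl _ = ⊥-elim (<.asym q q')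
      ... | tri> _ _ x = right-left x (<-trans q q') r'
      go (left-right p q r) (rising p' q') with <-cmp e g
      ... | tri< x _ _ = rising (◁-trans p p') x
      ... | tri≈ _ refl _ = ⊥-elim (◁.asym p p')
      ... | tri> _ _ x = left-right (◁-trans p p') x r
      go (left-right p q r) (left-right p' q' r') = left-right (◁-trans p p') (<-trans q' q) r
      go (left-right p q r) (right-left p' q' r') with ≺-cmp e g
      ... | tri< x _ _ = x
      ... | tri≈ _ refl _ with () ← trans (sym r) r'
      go (left-right p q r) (right-left p' q' r') | tri> _ _ (rising x y) =
        ⊥-elim (unobstructed ag x p q' y ea r' r)
      go (left-right p q r) (right-left p' q' r') | tri> _ _ (left-right x y s)
        with () ← trans (sym r') s
      go (left-right p q r) (right-left p' q' r') | tri> _ _ (right-left x y s)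
        with () ← trans (sym r) s
      go (right-left p q r) (rising p' q') with ≺-cmp e g
      ... | tri< x _ _ = x
      ... | tri≈ _ refl _ = ⊥-elim (<.asym q q')
      ... | tri> _ _ (rising x y) = ⊥-elim (<.asym y (<-trans q q'))
      ... | tri> _ _ (left-right x y s) = ⊥-elim (unobstructed af p' x q q' ga r s)
      ... | tri> _ _ (right-left x y s) = ⊥-elim (<.asym y (<-trans q q'))
      go (right-left p q r) (left-right p' q' r') with () ← trans (sym r) r'
      go (right-left p q r) (right-left p' q' r') = right-left (◁-trans p' p) (<-trans q q') r'

    rank-mono-< : ∀ {a e f} → Inv a e → Inv a f → e ≺ f → rank a e ℕ.< rank a f
    rank-mono-< {a} {e} {f} ae af e≺f = countFin-mono-< (crossedBefore? a e) (crossedBefore? a f)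
      e (≺-irrefl ∘ proj₂) (λ i (ai , i≺e) → ai , ≺-trans ai ae af i≺e e≺f) (ae , e≺f)

    rank-cancel-< : ∀ {a e f} → Inv a e → Inv a f → rank a e ℕ.< rank a f → e ≺ f
    rank-cancel-< {a} {e} {f} ae af lt with ≺-cmp e f
    ... | tri< x _ _ = x
    ... | tri≈ _ refl _ = ⊥-elim (ℕₚ.<-irrefl refl lt)
    ... | tri> _ _ x = ⊥-elim (ℕₚ.<-asym lt (rank-mono-< af ae x))

    -- The candidate `f` is replaced by any element strictly between `e` and `f`; its rank falls
    -- each time and bounds the recursion. When nothing lies between, the predecessors of `f` are
    -- those of `e` together with `e`.
    rank-successor : ∀ {a e f} → Inv a e → Inv a f → e ≺ f →
      ∃ λ g → Inv a g × rank a g ≡ suc (rank a e)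
    rank-successor {a} {e} {f} ae af e≺f = go (suc (rank a f)) f af e≺f ℕₚ.≤-refl
      where
      go : ∀ k f → Inv a f → e ≺ f → rank a f ℕ.< k → ∃ λ g → Inv a g × rank a g ≡ suc (rank a e)
      go (suc k) f af e≺f (ℕ.s≤s lt)
        with Finₚ.any? (λ g → inv? a g ×-dec (≺.dec e g ×-dec ≺.dec g f))
      ... | yes (g , ag , e≺g , g≺f) = go k g ag e≺g (ℕₚ.<-≤-trans (rank-mono-< ag af g≺f) lt)
      ... | no none = f , af , countFin-insert (crossedBefore? a e) (crossedBefore? a f)
        e (≺-irrefl ∘ proj₂) (λ i (ai , i≺e) → ai , ≺-trans ai ae af i≺e e≺f) (ae , e≺f) covered
        where
        covered : ∀ i → Inv a i × i ≺ f → (Inv a i × i ≺ e) ⊎ i ≡ e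
        covered i (ai , i≺f) with ≺-cmp i e
        ... | tri< x _ _ = inj₁ (ai , x)
        ... | tri≈ _ x _ = inj₂ x
        ... | tri> _ _ x = ⊥-elim (none (i , ai , x , i≺f))

  -- When `e` exceeds both `c` and `d`, it can precede them only through `left-right`, so position
  -- alone tells `c` from `d`.
  ≺-after : ∀ {c d e} → c ◁ d → c < e → d < e → e ≺ d → ¬ (e ≺ c) → rl e ≡ false × c ◁ e × e ◁ d
  ≺-after cd ce de (rising _ ed) _ = ⊥-elim (<.asym de ed)
  ≺-after cd ce de (right-left _ ed _) _ = ⊥-elim (<.asym de ed)
  ≺-after {c} {d} {e} cd ce de (left-right ed _ r) ¬q with ◁-cmp e c
  ... | tri< x _ _ = ⊥-elim (¬q (left-right x ce r))
  ... | tri≈ _ refl _ = ⊥-elim (<.irrefl ce)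
  ... | tri> _ _ x = r , x , ed

  ≺-after-mono : ∀ {c d e} → c ◁ d → c < e → d < e → e ≺ c → e ≺ d
  ≺-after-mono cd ce de (rising _ ec) = ⊥-elim (<.asym ce ec)
  ≺-after-mono cd ce de (right-left _ ec _) = ⊥-elim (<.asym ce ec)
  ≺-after-mono cd ce de (left-right ec _ r) = left-right (◁-trans ec cd) de r

  -- Since `e` lies to the left of `c`, it fails to precede `c` only if it is RL and larger than
  -- `c`; then `e ≺ d` must be `rising`.
  ≺-before : ∀ {c d e} → e ◁ c → e ◁ d → e ≺ d → ¬ (e ≺ c) → rl e ≡ true × c < e × e < d
  ≺-before {c} {d} {e} ec ed p ¬q with <-cmp e c
  ... | tri< x _ _ = ⊥-elim (¬q (rising ec x))
  ... | tri≈ _ refl _ = ⊥-elim (◁.irrefl ec)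
  ... | tri> _ _ x with rl e in r
  ...   | false = ⊥-elim (¬q (left-right ec x r))
  ...   | true with p
  ...     | rising _ y = refl , x , y
  ...     | left-right _ _ s with () ← trans (sym r) s
  ≺-before {c} {d} {e} ec ed p ¬q | tri> _ _ x | true | right-left y _ _ = ⊥-elim (◁.asym y ed)

  -- The exchange identity of a rec

  module Exchange {a b c d : Fin n} (rec : Rec a b c d) where
    private
      a◁b = proj₁ rec
      b◁c = proj₁ (proj₂ rec)
      c◁d = proj₁ (proj₂ (proj₂ rec))
      c<a = proj₁ (proj₂ (proj₂ (proj₂ rec)))
      c<b = proj₁ (proj₂ (proj₂ (proj₂ (proj₂ rec))))
      d<a = proj₁ (proj₂ (proj₂ (proj₂ (proj₂ (proj₂ rec)))))
      d<b = proj₂ (proj₂ (proj₂ (proj₂ (proj₂ (proj₂ rec)))))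
      b◁d = ◁-trans b◁c c◁d

    only-a : ∀ {e} → Inv a e → ¬ Inv b e → (e ◁ b) ⊎ e ≡ b ⊎ (b ◁ e × b < e)
    only-a {e} _ ¬be with ◁-cmp e b
    ... | tri< x _ _ = inj₁ x
    ... | tri≈ _ x _ = inj₂ (inj₁ x)
    ... | tri> _ x≢ x with <-cmp e b
    ...   | tri< y _ _ = ⊥-elim (¬be (y , x))
    ...   | tri≈ _ y _ = ⊥-elim (x≢ y)
    ...   | tri> _ _ y = inj₂ (inj₂ (x , y))

    only-b : ∀ {e} → ¬ Inv a e → Inv b e → a < e
    only-b {e} ¬ae (eb , be) with <-cmp a e
    ... | tri< x _ _ = x
    ... | tri≈ _ refl _ = ⊥-elim (◁.asym a◁b be)
    ... | tri> _ _ x = ⊥-elim (¬ae (x , ◁-trans a◁b be))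

    -- An `e` to the left of `b` falls under `≺-before`, one to the right of and above `b` under
    -- `≺-after`. The inequalities returned besides the switchback tell the kinds of rec apart: the
    -- second alternative forces `b < a`.
    a-later : ∀ {e} → Inv a e → ¬ Inv b e → e ≺ d → ¬ (e ≺ c) →
      (LeftSB a b c d e × c < e × e < d) ⊎ (RightSB a b c d e × b < e × e < a)
    a-later ae@(ea , ◁e) ¬be p ¬q with only-a ae ¬be
    ... | inj₁ eb with r , ce , ed ← ≺-before (◁-trans eb b◁c) (◁-trans eb b◁d) p ¬q =
      inj₁ ((r , ◁e , eb , inj₁ (ce , ed)) , ce , ed)
    ... | inj₂ (inj₁ refl) with _ , _ , x ← ≺-before b◁c b◁d p ¬q = ⊥-elim (<.asym x d<b)
    ... | inj₂ (inj₂ (be , b<e)) with r , ce , ed ← ≺-after c◁d (<-trans c<b b<e) (<-trans d<b b<e) p ¬q =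
      inj₂ ((r , ce , ed , inj₂ (b<e , ea)) , b<e , ea)

    a-earlier : ∀ {e} → Inv a e → ¬ Inv b e → ¬ (e ≺ d) → e ≺ c → LeftSB a b c d e × d < e × e < c
    a-earlier ae@(ea , ◁e) ¬be ¬p q with only-a ae ¬be
    ... | inj₁ eb with r , de , ec ← ≺-before (◁-trans eb b◁d) (◁-trans eb b◁c) q ¬p =
      (r , ◁e , eb , inj₂ (de , ec)) , de , ec
    ... | inj₂ (inj₁ refl) with _ , _ , x ← ≺-before b◁d b◁c q ¬p = ⊥-elim (<.asym x c<b)
    ... | inj₂ (inj₂ (be , b<e)) = ⊥-elim (¬p (≺-after-mono c◁d (<-trans c<b b<e) (<-trans d<b b<e) q))

    b-later : ∀ {e} → ¬ Inv a e → Inv b e → e ≺ d → ¬ (e ≺ c) → RightSB a b c d e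
    b-later ¬ae be p ¬q
      with a<e ← only-b ¬ae be
      with r , ce , ed ← ≺-after c◁d (<-trans c<a a<e) (<-trans d<a a<e) p ¬q =
      r , ce , ed , inj₁ (a<e , proj₁ be)

    b-earlier : ∀ {e} → ¬ Inv a e → Inv b e → ¬ (e ≺ d) → e ≺ c → ⊥
    b-earlier ¬ae be ¬p q with a<e ← only-b ¬ae be =
      ¬p (≺-after-mono c◁d (<-trans c<a a<e) (<-trans d<a a<e) q)

    leftSB⇒onlyA : a < b → c < d → ∀ e → LeftSB a b c d e →
      (Inv a e × ¬ Inv b e) × (e ≺ d × ¬ (e ≺ c))
    leftSB⇒onlyA a<b c<d e (r , ae , eb , inj₂ (de , ec)) = ⊥-elim (<.asym c<d (<-trans de ec))
    leftSB⇒onlyA a<b c<d e (r , ae , eb , inj₁ (ce , ed)) =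
      ((<-trans ed d<a , ae) , λ (_ , be) → ◁.asym be eb) , rising (◁-trans eb b◁d) ed , λ
        { (rising _ x) → <.asym ce x
        ; (left-right _ _ s) → true≢false (trans (sym r) s)
        ; (right-left x _ _) → ◁.asym x (◁-trans eb b◁c) }
      where
      true≢false : true ≢ false
      true≢false ()

    rightSB⇒onlyB : a < b → c < d → ∀ e → RightSB a b c d e →
      (¬ Inv a e × Inv b e) × (e ≺ d × ¬ (e ≺ c))
    rightSB⇒onlyB a<b c<d e (r , ce , ed , inj₂ (be , ea)) = ⊥-elim (<.asym a<b (<-trans be ea))
    rightSB⇒onlyB a<b c<d e (r , ce , ed , inj₁ (ae , eb)) =
      ((λ (ea , _) → <.asym ae ea) , eb , ◁-trans b◁c ce) , left-right ed (<-trans d<a ae) r , λ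
        { (rising x _) → ◁.asym x ce
        ; (left-right x _ _) → ◁.asym x ce
        ; (right-left _ x _) → <.asym x (<-trans c<a ae) }

    private
      OnlyA OnlyB : Fin n → Set
      OnlyA e = (Inv a e × ¬ Inv b e) × (e ≺ d × ¬ (e ≺ c))
      OnlyB e = (¬ Inv a e × Inv b e) × (e ≺ d × ¬ (e ≺ c))

      onlyA? : Decidable OnlyA
      onlyA? e = (inv? a e ×-dec ¬? (inv? b e)) ×-dec (≺.dec e d ×-dec ¬? (≺.dec e c))

      onlyB? : Decidable OnlyB
      onlyB? e = (¬? (inv? a e) ×-dec inv? b e) ×-dec (≺.dec e d ×-dec ¬? (≺.dec e c))

      -- Summing `exchange-indicators` over all `e` leaves two correction counts, which cancel if
      -- equal. One excluded row is always impossible by `b-earlier`; the other depends on the kind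
      -- of rec and is therefore an argument.
      exchange-counts : countFin onlyA? ≡ countFin onlyB? →
        (∀ e → Inv a e → ¬ Inv b e → ¬ (e ≺ d) → ¬ (e ≺ c)) →
        rank a d + rank b c ≡ rank b d + rank a c
      exchange-counts eq ¬a-earlier = ℕₚ.+-cancelʳ-≡ (countFin onlyB?) _ _ (begin
        (rank a d + rank b c) + countFin onlyB?
          ≡⟨ cong₂ _+_ (cong₂ _+_ (countFin≡sum (crossedBefore? a d)) (countFin≡sum (crossedBefore? b c)))
               (countFin≡sum onlyB?) ⟩
        (sum ad + sum bc) + sum (λ e → indicator (onlyB? e))
          ≡⟨ sum-of-three ad bc (λ e → indicator (onlyB? e)) ⟨
        sum (λ e → (ad e + bc e) + indicator (onlyB? e))
          ≡⟨ sum-cong-≗ (λ e → exchange-indicators (inv? a e) (inv? b e) (≺.dec e d) (≺.dec e c)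
               (¬a-earlier e) b-earlier) ⟩
        sum (λ e → (bd e + ac e) + indicator (onlyA? e))
          ≡⟨ sum-of-three bd ac (λ e → indicator (onlyA? e)) ⟩
        (sum bd + sum ac) + sum (λ e → indicator (onlyA? e))
          ≡⟨ cong₂ _+_ (cong₂ _+_ (countFin≡sum (crossedBefore? b d)) (countFin≡sum (crossedBefore? a c)))
               (countFin≡sum onlyA?) ⟨
        (rank b d + rank a c) + countFin onlyA?
          ≡⟨ cong (rank b d + rank a c +_) eq ⟩
        (rank b d + rank a c) + countFin onlyB? ∎)
        where
        open ≡-Reasoning
        ad bc bd ac : Fin n → ℕ
        ad e = indicator (crossedBefore? a d e)
        bc e = indicator (crossedBefore? b c e)
        bd e = indicator (crossedBefore? b d e)
        ac e = indicator (crossedBefore? a c e)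
        sum-of-three : (f g h : Fin n → ℕ) → sum (λ e → (f e + g e) + h e) ≡ (sum f + sum g) + sum h
        sum-of-three f g h = trans (∑-distrib-+ (λ e → f e + g e) h) (cong (_+ sum h) (∑-distrib-+ f g))

    -- In an irregular rec every contribution to a correction would be a switchback, so both
    -- corrections vanish. In a regular rec they are exactly the left and right switchbacks, because
    -- the remaining alternatives force `b < a` or `d < c`.
    exchange : Balanced → rank a d + rank b c ≡ rank b d + rank a c
    exchange bal with <.dec a b ×-dec <.dec c d
    ... | no irregular = exchange-counts (countFin-cong onlyA? onlyB?
            (λ e ((i , j) , p , q) → ⊥-elim (not-a e i j p q))
            (λ e ((i , j) , p , q) → ⊥-elim (proj₂ (¬sb e) (b-later i j p q))))
          (λ e i j p q → proj₁ (¬sb e) (proj₁ (a-earlier i j p q)))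
      where
      ¬sb = proj₂ (bal a b c d rec) irregular
      not-a : ∀ e → Inv a e → ¬ Inv b e → e ≺ d → ¬ ¬ (e ≺ c)
      not-a e i j p q with a-later i j p q
      ... | inj₁ (x , _) = proj₁ (¬sb e) x
      ... | inj₂ (x , _) = proj₂ (¬sb e) x
    ... | yes regular@(a<b , c<d) = exchange-counts
          (trans (countFin-cong onlyA? L? (λ _ → onlyA⇒leftSB) (leftSB⇒onlyA a<b c<d))
            (trans (proj₁ (bal a b c d rec) regular L? R?)
              (countFin-cong R? onlyB? (rightSB⇒onlyB a<b c<d) (λ _ → onlyB⇒rightSB))))
          (λ e i j p q → let _ , x , y = a-earlier i j p q in <.asym c<d (<-trans x y))
      where
      onlyA⇒leftSB : ∀ {e} → OnlyA e → LeftSB a b c d e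
      onlyA⇒leftSB ((i , j) , p , q) with a-later i j p q
      ... | inj₁ (x , _) = x
      ... | inj₂ (_ , x , y) = ⊥-elim (<.asym a<b (<-trans x y))
      onlyB⇒rightSB : ∀ {e} → OnlyB e → RightSB a b c d e
      onlyB⇒rightSB ((i , j) , p , q) = b-later i j p q
      L? : Decidable (LeftSB a b c d)
      L? e = map′ onlyA⇒leftSB (leftSB⇒onlyA a<b c<d e) (onlyA? e)
      R? : Decidable (RightSB a b c d)
      R? e = map′ onlyB⇒rightSB (rightSB⇒onlyB a<b c<d e) (onlyB? e)

-- Crossing times

private
  add-equations : ∀ {x y u v p q} → x ≡ y → u ≡ v → p ≡ q → x + u + p ≡ y + v + q
  add-equations refl refl refl = refl

  -- Here rab abbreviates rank a b and sba its mirror image rankᵐ b a (see new below).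
  shift-via-new : ∀ αa' αy rab rab″ ra'b ra'b″ ryb″ sba sb″a sba' sb″a' sb″y →
    αa' + (ra'b″ + sb″y) ≡ αy + (ryb″ + sb″a') →
    rab″ + ra'b ≡ ra'b″ + rab → sb″a + sba' ≡ sba + sb″a' →
    (αa' + (ra'b + sba)) + (rab″ + sb″y) ≡ (αy + (rab + sba')) + (ryb″ + sb″a)
  shift-via-new αa' αy rab rab″ ra'b ra'b″ ryb″ sba sb″a sba' sb″a' sb″y h k l =
    ℕₚ.+-cancelʳ-≡ (ra'b″ + sb″a') _ _
      (trans (lhs αa' rab″ ra'b ra'b″ sba sb″a' sb″y)
      (trans (add-equations h k (sym l)) (rhs αy rab ra'b″ ryb″ sb″a sba' sb″a')))
    where
    lhs : ∀ αa' rab″ ra'b ra'b″ sba sb″a' sb″y →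
      (αa' + (ra'b + sba)) + (rab″ + sb″y) + (ra'b″ + sb″a') ≡
      (αa' + (ra'b″ + sb″y)) + (rab″ + ra'b) + (sba + sb″a')
    lhs = solve-∀
    rhs : ∀ αy rab ra'b″ ryb″ sb″a sba' sb″a' →
      (αy + (ryb″ + sb″a')) + (ra'b″ + rab) + (sb″a + sba') ≡
      (αy + (rab + sba')) + (ryb″ + sb″a) + (ra'b″ + sb″a')
    rhs = solve-∀

  shift-via-old : ∀ αa' αy rab rab″ ra'b ryb ryb″ sba sb″a sba' sby sb″y →
    αa' + (ra'b + sby) ≡ αy + (ryb + sba') →
    rab″ + ryb ≡ ryb″ + rab → sb″a + sby ≡ sba + sb″y →
    (αa' + (ra'b + sba)) + (rab″ + sb″y) ≡ (αy + (rab + sba')) + (ryb″ + sb″a)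
  shift-via-old αa' αy rab rab″ ra'b ryb ryb″ sba sb″a sba' sby sb″y h k l =
    ℕₚ.+-cancelʳ-≡ (ryb + sby) _ _
      (trans (lhs αa' rab″ ra'b ryb sba sby sb″y)
      (trans (add-equations h k (sym l)) (rhs αy rab ryb ryb″ sb″a sba' sby)))
    where
    lhs : ∀ αa' rab″ ra'b ryb sba sby sb″y →
      (αa' + (ra'b + sba)) + (rab″ + sb″y) + (ryb + sby) ≡
      (αa' + (ra'b + sby)) + (rab″ + ryb) + (sba + sb″y)
    lhs = solve-∀
    rhs : ∀ αy rab ryb ryb″ sb″a sba' sby →
      (αy + (ryb + sba')) + (ryb″ + rab) + (sb″a + sby) ≡
      (αy + (rab + sba')) + (ryb″ + sb″a) + (ryb + sby)
    rhs = solve-∀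

  shift-both : ∀ x y p q k → x + p ≡ y + q → (x + k) + p ≡ (y + k) + q
  shift-both x y p q k h = trans (e x p k) (trans (cong (_+ k) h) (sym (e y q k)))
    where
    e : ∀ x p k → (x + k) + p ≡ (x + p) + k
    e = solve-∀

module Schedule {n : ℕ} {_◁_ _<_ : Fin n → Fin n → Set}
  (◁-trans : Transitive _◁_) (◁-cmp : Trichotomous _≡_ _◁_)
  (<-trans : Transitive _<_) (<-cmp : Trichotomous _≡_ _<_)
  (rl : Fin n → Bool)
  (bound : ℕ) (index : Fin n → ℕ) (index-< : ∀ a → index a ℕ.< bound)
  (index-mono : ∀ {a b} → a ◁ b → index a ℕ.< index b)
  where

  open Crossings ◁-trans ◁-cmp <-trans <-cmp rl
  -- `Mirror.Inv b a` unfolds to `Inv a b`, so one proof of an inversion serves both sides.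
  module Mirror = Crossings {_◁_ = flip _◁_} {_<_ = flip _<_}
    (λ p q → ◁-trans q p) (Flip.compare _ ◁-cmp) (λ p q → <-trans q p) (Flip.compare _ <-cmp) (not ∘ rl)

  private
    not-true : ∀ {x} → not x ≡ true → x ≡ false
    not-true {false} _ = refl

    not-false : ∀ {x} → not x ≡ false → x ≡ true
    not-false {true} _ = refl

  module _ (unobstructed : Unobstructed) (balanced : Balanced) where

    private
      rankᵐ = Mirror.rank

      unobstructedᵐ : Mirror.Unobstructed
      unobstructedᵐ da ab bc ca a<b bd ra rb =
        unobstructed bc ab da bd a<b ca (not-false rb) (not-true ra)

      -- Reflection reverses a rec, keeps it regular or irregular, and exchanges its left and right
      -- switchbacks.
      balancedᵐ : Mirror.Balanced
      balancedᵐ d c b a (dc , cb , ba , bd , bc , ad , ac)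
        with balanced a b c d (ba , cb , dc , ac , bc , ad , bd)
      ... | regular , irregular =
        (λ (c<d , a<b) P? Q? →
          let L? e = map′ (fromʳ e) (toʳ e) (Q? e)
              R? e = map′ (fromˡ e) (toˡ e) (P? e)
          in trans (countFin-cong P? R? fromˡ toˡ)
               (trans (sym (regular (a<b , c<d) L? R?)) (countFin-cong L? Q? toʳ fromʳ))) ,
        λ ¬reg e → let ¬left , ¬right = irregular (λ (a<b , c<d) → ¬reg (c<d , a<b)) e in
          ¬right ∘ fromˡ e , ¬left ∘ fromʳ e
        where
        fromˡ : ∀ e → Mirror.LeftSB d c b a e → RightSB a b c d e
        fromˡ e (r , ed , ce , inj₁ (eb , ae)) = not-true r , ce , ed , inj₁ (ae , eb)
        fromˡ e (r , ed , ce , inj₂ (ea , be)) = not-true r , ce , ed , inj₂ (be , ea)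
        toˡ : ∀ e → RightSB a b c d e → Mirror.LeftSB d c b a e
        toˡ e (r , ce , ed , inj₁ (ae , eb)) = cong not r , ed , ce , inj₁ (eb , ae)
        toˡ e (r , ce , ed , inj₂ (be , ea)) = cong not r , ed , ce , inj₂ (ea , be)
        fromʳ : ∀ e → Mirror.RightSB d c b a e → LeftSB a b c d e
        fromʳ e (r , eb , ae , inj₁ (ed , ce)) = not-false r , ae , eb , inj₁ (ce , ed)
        fromʳ e (r , eb , ae , inj₂ (ec , de)) = not-false r , ae , eb , inj₂ (de , ec)
        toʳ : ∀ e → LeftSB a b c d e → Mirror.RightSB d c b a e
        toʳ e (r , ae , eb , inj₁ (ce , ed)) = cong not r , eb , ae , inj₁ (ed , ce)
        toʳ e (r , ae , eb , inj₂ (de , ec)) = cong not r , eb , ae , inj₂ (ec , de)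

      FourCycle : Fin n → Fin n → Fin n → Fin n → Set
      FourCycle a a' b b' =
        rank a b' + rank a' b ≡ rank a' b' + rank a b ×
        rankᵐ b' a + rankᵐ b a' ≡ rankᵐ b a + rankᵐ b' a'

      swapˡ : ∀ {a a' b b'} → FourCycle a a' b b' → FourCycle a' a b b'
      swapˡ {a} {a'} {b} {b'} (p , q) = sym p ,
        trans (ℕₚ.+-comm (rankᵐ b' a') _) (trans (sym q) (ℕₚ.+-comm (rankᵐ b' a) _))

      swapʳ : ∀ {a a' b b'} → FourCycle a a' b b' → FourCycle a a' b' b
      swapʳ {a} {a'} {b} {b'} (p , q) =
        trans (ℕₚ.+-comm (rank a b) _) (trans (sym p) (ℕₚ.+-comm (rank a b') _)) , sym q

      four-cycle-rec : ∀ {a a' b b'} → Rec a a' b b' → FourCycle a a' b b'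
      four-cycle-rec rec@(aa' , a'b , bb' , b<a , b<a' , b'<a , b'<a') =
        Exchange.exchange rec balanced ,
        Mirror.Exchange.exchange (bb' , a'b , aa' , b'<a' , b<a' , b'<a , b<a) balancedᵐ

      -- Both crossed elements lie after both crossing ones, so sorting each pair by position yields
      -- a rec. The equations survive both exchanges and are trivial if an element is repeated.
      four-cycle : ∀ {a a' b b'} → Inv a b → Inv a' b → Inv a b' → Inv a' b' → FourCycle a a' b b'
      four-cycle {a} {a'} {b} {b'} (p , p') (q , q') (r , r') (s , s') with ◁-cmp a a' | ◁-cmp b b'
      ... | tri≈ _ refl _ | _ = refl , ℕₚ.+-comm (rankᵐ b' a) _
      ... | _ | tri≈ _ refl _ = ℕₚ.+-comm (rank a b) _ , refl
      ... | tri< x _ _ | tri< y _ _ = four-cycle-rec (x , q' , y , p , q , r , s)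
      ... | tri< x _ _ | tri> _ _ y = swapʳ (four-cycle-rec (x , s' , y , r , s , p , q))
      ... | tri> _ _ x | tri< y _ _ = swapˡ (four-cycle-rec (x , p' , y , q , p , s , r))
      ... | tri> _ _ x | tri> _ _ y = swapˡ (swapʳ (four-cycle-rec (x , r' , y , s , r , q , p)))

      -- With the subtraction restored: `α a + rank a b - rankᵐ b a` agrees with its value at `a'`.
      -- The common value is the eliminated offset β of `b`.
      Consistent : (Fin n → ℕ) → Fin n → Fin n → Set
      Consistent α a a' = ∀ b → Inv a b → Inv a' b →
        α a + (rank a b + rankᵐ b a') ≡ α a' + (rank a' b + rankᵐ b a)

      -- Only the first common partner found is used to place a new element.  Any two
      -- partners of it lie after all earlier elements, so the smaller of them is shared
      -- by every earlier element involved, and four-cycles transport the equation.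
      offsets-upto : ∀ k → Σ (Fin n → ℕ) λ α →
        ∀ a a' → index a ℕ.< k → index a' ℕ.< k → Consistent α a a'
      offsets-upto zero = (λ _ → 0) , λ _ _ ()
      offsets-upto (suc k) with offsets-upto k | Finₚ.any? (λ a → index a ℕ.≟ k)
      ... | α , ok | no none = α , λ a a' a< a'< → ok a a' (below a a<) (below a' a'<)
        where
        below : ∀ a → index a ℕ.< suc k → index a ℕ.< k
        below a a< = ℕₚ.≤∧≢⇒< (ℕₚ.≤-pred a<) (λ eq → none (a , eq))
      ... | α , ok | yes (a , refl) = extend
        (Finₚ.any? λ a' → Finₚ.any? λ b → (index a' ℕ.<? index a) ×-dec (inv? a b ×-dec inv? a' b))
        where
        index-injective : ∀ {x y} → index x ≡ index y → x ≡ y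
        index-injective {x} {y} eq with ◁-cmp x y
        ... | tri< p _ _ = ⊥-elim (ℕₚ.<⇒≢ (index-mono p) eq)
        ... | tri≈ _ p _ = p
        ... | tri> _ _ p = ⊥-elim (ℕₚ.<⇒≢ (index-mono p) (sym eq))

        ◁-reflect : ∀ {x y} → index x ℕ.< index y → x ◁ y
        ◁-reflect {x} {y} lt with ◁-cmp x y
        ... | tri< p _ _ = p
        ... | tri≈ _ refl _ = ⊥-elim (ℕₚ.<-irrefl refl lt)
        ... | tri> _ _ p = ⊥-elim (ℕₚ.<-asym lt (index-mono p))

        below : ∀ {x} → x ≢ a → index x ℕ.< suc (index a) → index x ℕ.< index a
        below x≢a x< = ℕₚ.≤∧≢⇒< (ℕₚ.≤-pred x<) (λ eq → x≢a (index-injective eq))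

        consistent-all : (α : Fin n → ℕ) →
          (∀ x y → index x ℕ.< index a → index y ℕ.< index a → Consistent α x y) →
          (∀ y → index y ℕ.< index a → Consistent α a y) →
          ∀ x y → index x ℕ.< suc (index a) → index y ℕ.< suc (index a) → Consistent α x y
        consistent-all α old new x y x< y< b xb yb with x Fin.≟ a | y Fin.≟ a
        ... | yes refl | yes refl = refl
        ... | yes refl | no y≢a = new y (below y≢a y<) b xb yb
        ... | no x≢a | yes refl = sym (new x (below x≢a x<) b yb xb)
        ... | no x≢a | no y≢a = old x y (below x≢a x<) (below y≢a y<) b xb yb

        extend : _ → Σ (Fin n → ℕ) λ α →
          ∀ x y → index x ℕ.< suc (index a) → index y ℕ.< suc (index a) → Consistent α x y
        extend (no isolated) = α , consistent-all α ok
          (λ y y< b ab yb → ⊥-elim (isolated (y , b , y< , ab , yb)))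
        extend (yes (a' , b , a'< , ab , a'b)) = α⁺ , consistent-all α⁺ old new
          where
          α⁺ : Fin n → ℕ
          -- The equation at `b` would have `rank a b + rankᵐ b a'` subtracted from the offset of
          -- `a`. Raising every other offset by that amount instead avoids subtraction and leaves
          -- the equations among the old elements intact.
          α⁺ x = if does (x Fin.≟ a) then α a' + (rank a' b + rankᵐ b a)
                 else α x + (rank a b + rankᵐ b a')

          α⁺-new : α⁺ a ≡ α a' + (rank a' b + rankᵐ b a)
          α⁺-new with a Fin.≟ a
          ... | yes _ = refl
          ... | no a≢a = ⊥-elim (a≢a refl)

          α⁺-old : ∀ {x} → index x ℕ.< index a → α⁺ x ≡ α x + (rank a b + rankᵐ b a')
          α⁺-old {x} x< with x Fin.≟ a
          ... | yes refl = ⊥-elim (ℕₚ.<-irrefl refl x<)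
          ... | no _ = refl

          old : ∀ x y → index x ℕ.< index a → index y ℕ.< index a → Consistent α⁺ x y
          old x y x< y< c xc yc rewrite α⁺-old x< | α⁺-old y< =
            shift-both (α x) (α y) (rank x c + rankᵐ c y) (rank y c + rankᵐ c x) _ (ok x y x< y< c xc yc)

          new : ∀ y → index y ℕ.< index a → Consistent α⁺ a y
          new y y< c ac yc rewrite α⁺-new | α⁺-old y< = via (<-cmp b c)
            where
            via-b : Inv y b → _
            via-b yb = let p , q = four-cycle ab yb ac yc in
              shift-via-old (α a') (α y) (rank a b) (rank a c) (rank a' b) (rank y b) (rank y c)
                (rankᵐ b a) (rankᵐ c a) (rankᵐ b a') (rankᵐ b y) (rankᵐ c y)
                (ok a' y a'< y< b a'b yb) p q
            via-c : Inv a' c → _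
            via-c a'c = let p , q = four-cycle ab a'b ac a'c in
              shift-via-new (α a') (α y) (rank a b) (rank a c) (rank a' b) (rank a' c) (rank y c)
                (rankᵐ b a) (rankᵐ c a) (rankᵐ b a') (rankᵐ c a') (rankᵐ c y)
                (ok a' y a'< y< c a'c yc) p q
            via : _ → _
            via (tri≈ _ refl _) = via-b yc
            via (tri< b<c _ _) = via-b (<-trans b<c (proj₁ yc) , ◁-trans (◁-reflect y<) (proj₂ ab))
            via (tri> _ _ c<b) = via-c (<-trans c<b (proj₁ a'b) , ◁-trans (◁-reflect a'<) (proj₂ ac))

      offset : Fin n → ℕ
      offset = proj₁ (offsets-upto bound)

      offset-consistent : ∀ {a a' b} → Inv a b → Inv a' b →
        offset a + (rank a b + rankᵐ b a') ≡ offset a' + (rank a' b + rankᵐ b a)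
      offset-consistent {a} {a'} = proj₂ (offsets-upto bound) a a' (index-< a) (index-< a') _

    -- The `suc` keeps time 0 free of crossings, so that the first two permutations agree.
    time : Fin n → Fin n → ℕ
    time a b = suc (offset a + rank a b)

    time-monoʳ : ∀ {a e f} → Inv a e → Inv a f → e ≺ f → time a e ℕ.< time a f
    time-monoʳ {a} ae af e≺f = ℕ.s<s (ℕₚ.+-monoʳ-< (offset a) (rank-mono-< unobstructed ae af e≺f))

    time-contiguousʳ : ∀ {a e f} → Inv a e → Inv a f → time a e ℕ.< time a f →
      ∃ λ g → Inv a g × time a g ≡ suc (time a e)
    time-contiguousʳ {a} {e} ae af (ℕ.s<s lt)
      with g , ag , eq ← rank-successor unobstructed ae af
             (rank-cancel-< unobstructed ae af (ℕₚ.+-cancelˡ-< (offset a) _ _ lt)) =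
      g , ag , cong suc (trans (cong (offset a +_) eq) (ℕₚ.+-suc (offset a) _))

    private
      -- On the elements that cross `b`, `time` and `rankᵐ b` differ by a constant. Order and
      -- successors thus pass between mirrored ranks and times.
      time-balance : ∀ {a a' b} → Inv a b → Inv a' b → time a b + rankᵐ b a' ≡ time a' b + rankᵐ b a
      time-balance {a} {a'} {b} ab a'b = cong suc (trans (ℕₚ.+-assoc (offset a) _ _)
        (trans (offset-consistent ab a'b) (sym (ℕₚ.+-assoc (offset a') _ _))))

      <-from-balance : ∀ {x y p q} → x + p ≡ y + q → q ℕ.< p → x ℕ.< y
      <-from-balance {x} {y} {p} {q} eq q<p = ℕₚ.+-cancelʳ-< q x y
        (subst (x + q ℕ.<_) eq (ℕₚ.+-monoʳ-< x q<p))

    time-monoˡ : ∀ {e f b} → Inv e b → Inv f b → e Mirror.≺ f → time e b ℕ.< time f b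
    time-monoˡ eb fb e≺f =
      <-from-balance (time-balance eb fb) (Mirror.rank-mono-< unobstructedᵐ eb fb e≺f)

    time-contiguousˡ : ∀ {e f b} → Inv e b → Inv f b → time e b ℕ.< time f b →
      ∃ λ g → Inv g b × time g b ≡ suc (time e b)
    time-contiguousˡ {e} {f} {b} eb fb lt
      with g , gb , eq ← Mirror.rank-successor unobstructedᵐ eb fb
             (Mirror.rank-cancel-< unobstructedᵐ eb fb
               (<-from-balance (sym (trans (ℕₚ.+-comm _ (time e b))
                  (trans (time-balance eb fb) (ℕₚ.+-comm (time f b) _)))) lt)) =
      g , gb , ℕₚ.+-cancelʳ-≡ (rankᵐ b e) _ _
        (trans (sym (time-balance eb gb)) (trans (cong (time e b +_) eq) (ℕₚ.+-suc (time e b) _)))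

    time-smaller : ∀ {a e b} → a ◁ e → e ◁ b → e < b → b < a → time a e ℕ.< time a b
    time-smaller ae eb e<b b<a =
      time-monoʳ (<-trans e<b b<a , ae) (b<a , ◁-trans ae eb) (rising eb e<b)

    time-larger : ∀ {a e b} → a ◁ e → e ◁ b → b < a → a < e → time e b ℕ.< time a b
    time-larger ae eb b<a a<e =
      time-monoˡ (<-trans b<a a<e , eb) (b<a , ◁-trans ae eb) (Mirror.rising ae a<e)

    time-LR : ∀ {a e b} → a ◁ e → e ◁ b → b < e → e < a → rl e ≡ false →
      time a e ℕ.< time a b × time a b ℕ.< time e b
    time-LR ae eb b<e e<a r =
      time-monoʳ (e<a , ae) (<-trans b<e e<a , ◁-trans ae eb) (left-right eb b<e r) ,
      time-monoˡ (<-trans b<e e<a , ◁-trans ae eb) (b<e , eb) (Mirror.right-left ae e<a (cong not r))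

    time-RL : ∀ {a e b} → a ◁ e → e ◁ b → b < e → e < a → rl e ≡ true →
      time e b ℕ.< time a b × time a b ℕ.< time a e
    time-RL ae eb b<e e<a r =
      time-monoˡ (b<e , eb) (<-trans b<e e<a , ◁-trans ae eb) (Mirror.left-right ae e<a (cong not r)) ,
      time-monoʳ (<-trans b<e e<a , ◁-trans ae eb) (e<a , ae) (right-left eb b<e r)

-- Positions and simultaneous swaps

injective⇒surjective : (f : Fin n → Fin n) → (∀ {i j} → f i ≡ f j → i ≡ j) → ∀ k → ∃ λ i → f i ≡ k
injective⇒surjective {suc n} f inj k with Finₚ.any? (λ i → f i Fin.≟ k)
... | yes found = found
... | no missing = ⊥-elim (clash (Finₚ.pigeonhole (ℕₚ.n<1+n n) (λ i → punchOut (avoid i))))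
  where
  avoid : ∀ i → k ≢ f i
  avoid i k≡ = missing (i , sym k≡)
  clash : (∃₂ λ i j → i Fin.< j × punchOut (avoid i) ≡ punchOut (avoid j)) → ⊥
  clash (i , j , i<j , eq) =
    ℕₚ.<⇒≢ i<j (cong toℕ (inj (Finₚ.punchOut-injective (avoid i) (avoid j) eq)))

pos-lookup-≤ : (w : Vec (Fin n) k) (i : Fin k) → pos w (lookup w i) ≤ toℕ i
pos-lookup-≤ (y ∷ ys) zero with y Fin.≟ y
... | yes _ = ℕ.z≤n
... | no y≢y = ⊥-elim (y≢y refl)
pos-lookup-≤ (y ∷ ys) (suc i) with y Fin.≟ lookup ys i
... | yes _ = ℕ.z≤n
... | no _ = ℕ.s≤s (pos-lookup-≤ ys i)

lookup-pos : (w : Vec (Fin n) k) (x : Fin n) (i : Fin k) → pos w x ≡ toℕ i → lookup w i ≡ x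
lookup-pos (y ∷ ys) x i eq with y Fin.≟ x
lookup-pos (y ∷ ys) x zero eq | yes y≡x = y≡x
lookup-pos (y ∷ ys) x (suc i) eq | no _ = lookup-pos ys x i (ℕₚ.suc-injective eq)

-- `pos` of an absent element is the length of the vector, so this says that every element occurs.
Complete : Perm n → Set
Complete {n} w = ∀ x → pos w x < n

isPerm⇒complete : (w : Perm n) → IsPerm w → Complete w
isPerm⇒complete w inj x with i , refl ← injective⇒surjective (lookup w) (inj _ _) x =
  ℕₚ.≤-<-trans (pos-lookup-≤ w i) (Finₚ.toℕ<n i)

pos-injective : (w : Perm n) → Complete w → ∀ {x y} → pos w x ≡ pos w y → x ≡ y
pos-injective w comp {x} {y} eq = trans (sym (lookup-pos w x i (sym (Finₚ.toℕ-fromℕ< (comp x)))))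
  (lookup-pos w y i (trans (sym eq) (sym (Finₚ.toℕ-fromℕ< (comp x)))))
  where i = fromℕ< (comp x)

element-at : (w : Perm n) → Complete w → ∀ {i} → i < n → ∃ λ x → pos w x ≡ i
element-at w comp i<n with x , eq ← injective⇒surjective (λ x → fromℕ< (comp x))
  (λ {x} {y} eq → pos-injective w comp (Finₚ.fromℕ<-injective _ _ (comp x) (comp y) eq)) (fromℕ< i<n) =
  x , Finₚ.fromℕ<-injective _ _ (comp x) i<n eq

before-connex : (w : Perm n) → Complete w → ∀ {x y} → x ≢ y → ¬ Before w x y → Before w y x
before-connex w comp x≢y x≮y = ℕₚ.≤∧≢⇒< (ℕₚ.≮⇒≥ x≮y) (x≢y ∘ sym ∘ pos-injective w comp)

-- Counting up from the least element bounds each position below by the value, and counting down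
-- from the greatest bounds it above.
monotone⇒identity : (w : Perm n) → Complete w → (∀ {x y} → x Fin.< y → Before w x y) → w ≡ identity n
monotone⇒identity {n} w comp mono = trans (sym (Vecₚ.tabulate∘lookup w)) (Vecₚ.tabulate-cong fixed)
  where
  lower : ∀ k (x : Fin n) → toℕ x ≡ k → k ≤ pos w x
  lower zero x eq = ℕ.z≤n
  lower (suc k) x eq = ℕₚ.≤-<-trans (lower k y y≡k) (mono (ℕₚ.≤-reflexive (trans (cong suc y≡k) (sym eq))))
    where
    k<n : k < n
    k<n = ℕₚ.<-trans (ℕₚ.≤-reflexive (sym eq)) (Finₚ.toℕ<n x)
    y = fromℕ< k<n
    y≡k = Finₚ.toℕ-fromℕ< k<n
  upper : ∀ k (x : Fin n) → toℕ x + suc k ≡ n → pos w x + suc k ≤ n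
  upper zero x eq = subst (_≤ n) (sym (ℕₚ.+-comm (pos w x) 1)) (comp x)
  upper (suc k) x eq = ℕₚ.≤-trans (subst (_≤ pos w y + suc k) (sym (ℕₚ.+-suc (pos w x) (suc k)))
      (ℕₚ.+-monoˡ-≤ (suc k) (mono (ℕₚ.≤-reflexive (sym y≡)))))
    (upper k y (trans (cong (_+ suc k) y≡) (trans (sym (ℕₚ.+-suc (toℕ x) (suc k))) eq)))
    where
    sx<n : suc (toℕ x) < n
    sx<n = subst (suc (suc (toℕ x)) ≤_) eq
      (subst (_≤ toℕ x + suc (suc k)) (ℕₚ.+-comm (toℕ x) 2) (ℕₚ.+-monoʳ-≤ (toℕ x) (ℕ.s≤s (ℕ.s≤s ℕ.z≤n))))
    y = fromℕ< sx<n
    y≡ = Finₚ.toℕ-fromℕ< sx<n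
  fixed : ∀ x → lookup w x ≡ x
  fixed x = lookup-pos w x x (ℕₚ.≤-antisym (ℕₚ.+-cancelʳ-≤ (suc gap) _ _
      (ℕₚ.≤-trans (upper gap x sum≡n) (ℕₚ.≤-reflexive (sym sum≡n)))) (lower (toℕ x) x refl))
    where
    gap = n ℕ.∸ suc (toℕ x)
    sum≡n : toℕ x + suc gap ≡ n
    sum≡n = trans (ℕₚ.+-suc (toℕ x) gap) (ℕₚ.m+[n∸m]≡n (Finₚ.toℕ<n x))

transpose : ℕ → ℕ → ℕ
transpose zero zero = 1
transpose zero (suc zero) = 0
transpose zero (suc (suc i)) = suc (suc i)
transpose (suc p) zero = zero
transpose (suc p) (suc i) = suc (transpose p i)

transpose-left : ∀ p → transpose p p ≡ suc p
transpose-left zero = refl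
transpose-left (suc p) = cong suc (transpose-left p)

transpose-right : ∀ p → transpose p (suc p) ≡ p
transpose-right zero = refl
transpose-right (suc p) = cong suc (transpose-right p)

transpose-other : ∀ p i → i ≢ p → i ≢ suc p → transpose p i ≡ i
transpose-other zero zero h k = ⊥-elim (h refl)
transpose-other zero (suc zero) h k = ⊥-elim (k refl)
transpose-other zero (suc (suc i)) h k = refl
transpose-other (suc p) zero h k = refl
transpose-other (suc p) (suc i) h k = cong suc (transpose-other p i (h ∘ cong suc) (k ∘ cong suc))

-- `pos` sees only first occurrences. The witnesses `a` and `b` ensure that the entries at `p` and
-- `suc p` are such; a repeated entry would not move as `transpose` predicts.
pos-swapAt : (w : Vec (Fin n) k) (p : ℕ) {a b : Fin n} → pos w a ≡ p → pos w b ≡ suc p → suc p < k →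
  ∀ x → pos (swapAt p w) x ≡ transpose p (pos w x)
pos-swapAt (y ∷ []) p pa pb (ℕ.s≤s ()) x
pos-swapAt (y ∷ z ∷ ws) zero {a} {b} pa pb p<k x with y Fin.≟ a | y Fin.≟ b | z Fin.≟ b
... | yes refl | no y≢b | yes refl with z Fin.≟ x | y Fin.≟ x
...   | yes refl | yes refl = ⊥-elim (y≢b refl)
...   | yes _ | no _ = refl
...   | no _ | yes _ = refl
...   | no _ | no _ = refl
pos-swapAt (y ∷ w@(_ ∷ _)) (suc p) {a} {b} pa pb (ℕ.s≤s p<k) x with y Fin.≟ a | y Fin.≟ b
... | no _ | no _ with y Fin.≟ x
...   | yes _ = refl
...   | no _ = cong suc (pos-swapAt w p (ℕₚ.suc-injective pa) (ℕₚ.suc-injective pb) p<k x)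

transposes : List ℕ → ℕ → ℕ
transposes ps i = List.foldr transpose i ps

transposes-fixed : ∀ ps {i} → All (λ p → i ≢ p × i ≢ suc p) ps → transposes ps i ≡ i
transposes-fixed [] [] = refl
transposes-fixed (p ∷ ps) ((h , k) ∷ hs) =
  trans (cong (transpose p) (transposes-fixed ps hs)) (transpose-other p _ h k)

farApart-left : ∀ {p q} → FarApart p q → p ≢ q × p ≢ suc q
farApart-left (inj₁ lt) =
  (λ { refl → ℕₚ.1+n≰n (ℕₚ.<⇒≤ lt) }) ,
  λ { refl → ℕₚ.1+n≰n (ℕₚ.≤-trans (ℕₚ.m≤n+m _ 2) lt) }
farApart-left (inj₂ lt) = (λ { refl → ℕₚ.1+n≰n (ℕₚ.<⇒≤ lt) }) , λ { refl → ℕₚ.<-irrefl refl lt }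

farApart-right : ∀ {p q} → FarApart p q → suc p ≢ q × suc p ≢ suc q
farApart-right (inj₁ lt) = (λ { refl → ℕₚ.<-irrefl refl lt }) , λ { refl → ℕₚ.1+n≰n (ℕₚ.<⇒≤ lt) }
farApart-right (inj₂ lt) =
  (λ { refl → ℕₚ.1+n≰n (ℕₚ.≤-trans (ℕₚ.m≤n+m _ 2) lt) }) ,
  λ { refl → ℕₚ.1+n≰n (ℕₚ.<⇒≤ lt) }

farApart-sym : ∀ {p q} → FarApart p q → FarApart q p
farApart-sym (inj₁ lt) = inj₂ lt
farApart-sym (inj₂ lt) = inj₁ lt

transposes-∈ : ∀ {ps p} → AllPairs FarApart ps → p ∈ ps →
  transposes ps p ≡ suc p × transposes ps (suc p) ≡ p
transposes-∈ {p ∷ ps} (far ∷ _) (here refl) =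
  trans (cong (transpose p) (transposes-fixed ps (All.map farApart-left far))) (transpose-left p) ,
  trans (cong (transpose p) (transposes-fixed ps (All.map farApart-right far))) (transpose-right p)
transposes-∈ {q ∷ ps} {p} (far ∷ fars) (there p∈) with eq , eq' ← transposes-∈ fars p∈ =
  let d = farApart-sym (All.lookup far p∈)
      h , k = farApart-left d
      h' , k' = farApart-right d
  in trans (cong (transpose q) eq) (transpose-other q (suc p) h' k') ,
     trans (cong (transpose q) eq') (transpose-other q p h k)

SwapsAt : Vec (Fin n) k → ℕ → Set
SwapsAt {n} {k} w p = suc p < k × ∃₂ λ a b → pos w a ≡ p × pos w b ≡ suc p

-- The swaps in the tail fix `p` and `suc p`, so the witnesses are still there when `swapAt p` is
-- applied.
pos-swaps : (w : Vec (Fin n) k) (ps : List ℕ) → All (SwapsAt w) ps → AllPairs FarApart ps →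
  ∀ x → pos (List.foldr swapAt w ps) x ≡ transposes ps (pos w x)
pos-swaps w [] [] [] x = refl
pos-swaps w (p ∷ ps) ((p<k , a , b , pa , pb) ∷ swaps) (far ∷ fars) x =
  trans (pos-swapAt (List.foldr swapAt w ps) p
    (trans (pos-swaps w ps swaps fars a)
      (trans (cong (transposes ps) pa) (transposes-fixed ps (All.map farApart-left far))))
    (trans (pos-swaps w ps swaps fars b)
      (trans (cong (transposes ps) pb) (transposes-fixed ps (All.map farApart-right far))))
    p<k x)
  (cong (transpose p) (pos-swaps w ps swaps fars x))

-- Executing a schedule of crossings

record CrossingTimes (π : Perm n) (rl : Fin n → Bool) : Set where
  field
    time : Fin n → Fin n → ℕ
    time-positive : ∀ a b → time a b ≢ 0
    time-smaller : ∀ {a e b} → Before π a e → Before π e b → e Fin.< b → b Fin.< a →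
      time a e < time a b
    time-larger : ∀ {a e b} → Before π a e → Before π e b → b Fin.< a → a Fin.< e →
      time e b < time a b
    time-LR : ∀ {a e b} → Before π a e → Before π e b → b Fin.< e → e Fin.< a → rl e ≡ false →
      time a e < time a b × time a b < time e b
    time-RL : ∀ {a e b} → Before π a e → Before π e b → b Fin.< e → e Fin.< a → rl e ≡ true →
      time e b < time a b × time a b < time a e
    time-contiguousʳ : ∀ {a e f} → Inversion π a e → Inversion π a f → time a e < time a f →
      ∃ λ g → Inversion π a g × time a g ≡ suc (time a e)
    time-contiguousˡ : ∀ {e f b} → Inversion π e b → Inversion π f b → time e b < time f b →
      ∃ λ g → Inversion π g b × time g b ≡ suc (time e b)

module Execution (π : Perm n) (complete : Complete π) (rl : Fin n → Bool)
  (times : CrossingTimes π rl) where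

  open CrossingTimes times

  time-between : ∀ {a e b} → Before π a e → Before π e b → b Fin.< e → e Fin.< a →
    (time a e < time a b × time a b < time e b) ⊎ (time e b < time a b × time a b < time a e)
  time-between {e = e} ae eb be ea with rl e in r
  ... | true = inj₂ (time-RL ae eb be ea r)
  ... | false = inj₁ (time-LR ae eb be ea r)

  private
    Inv = Inversion π

    inv? : ∀ a b → Dec (Inv a b)
    inv? a b = (b Fin.<? a) ×-dec (pos π a ℕ.<? pos π b)

  Crosses : ℕ → Fin n → Fin n → Set
  Crosses t a b = Inv a b × time a b ≡ t

  crosses? : ∀ t a b → Dec (Crosses t a b)
  crosses? t a b = inv? a b ×-dec (time a b ℕ.≟ t)

  -- The time of the outer pair `a`, `b` lies strictly between the two times that would coincide.
  crosses-one-way : ∀ {t a e b} → Crosses t a e → ¬ Crosses t e b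
  crosses-one-way ((ea , ae) , refl) ((be , eb) , eq) with time-between ae eb be ea
  ... | inj₁ (p , q) = ℕₚ.<⇒≢ (ℕₚ.<-trans p q) (sym eq)
  ... | inj₂ (p , q) = ℕₚ.<⇒≢ (ℕₚ.<-trans p q) eq

  rightMover? : ∀ t → Decidable (λ a → ∃ (Crosses t a))
  rightMover? t a = Finₚ.any? (crosses? t a)

  swapPositions : ℕ → Perm n → List ℕ
  swapPositions t w = List.map (pos w) (filter (rightMover? t) (allFin n))

  advance : ℕ → Perm n → Perm n
  advance t w = List.foldr swapAt w (swapPositions t w)

  -- `pending` and `waiting` together: the pairs out of order in `w` are exactly the inversions with
  -- time at least `t`.
  record State (t : ℕ) (w : Perm n) : Set where
    field
      present : Complete w
      pending : ∀ {a b} → b Fin.< a → Before w a b → Inv a b × t ≤ time a b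
      waiting : ∀ {a b} → Inv a b → t ≤ time a b → Before w a b

  module Step {t : ℕ} {w : Perm n} (state : State t w) where
    open State state

    -- Such an `e` is out of order with `a` or with `b`, so by `pending` that crossing is not before
    -- `t`. The order of the three crossing times then either demands an earlier crossing or, by
    -- `waiting`, puts `e` on the other side.
    nothing-between : ∀ {a b e} → Crosses t a b → Before w a e → ¬ Before w e b
    nothing-between {a} {b} {e} ((ba , ab) , refl) ae eb with Finₚ.<-cmp e a | Finₚ.<-cmp e b
    ... | tri≈ _ refl _ | _ = ℕₚ.<-irrefl refl ae
    ... | _ | tri≈ _ refl _ = ℕₚ.<-irrefl refl eb
    ... | tri< e<a _ _ | tri> _ _ b<e
      with (_ , a◁e) , t≤ae ← pending e<a ae
      with (_ , e◁b) , t≤eb ← pending b<e eb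
      with time-between a◁e e◁b b<e e<a
    ...   | inj₁ (lt , _) = ℕₚ.<⇒≱ lt t≤ae
    ...   | inj₂ (lt , _) = ℕₚ.<⇒≱ lt t≤eb
    nothing-between {a} {b} {e} ((ba , ab) , refl) ae eb | tri< e<a _ _ | tri< e<b _ _
      with (_ , a◁e) , t≤ae ← pending e<a ae
      with ℕₚ.<-cmp (pos π e) (pos π b)
    ... | tri≈ _ p≡ _ = ℕₚ.<⇒≢ e<b (cong toℕ (pos-injective π complete p≡))
    ... | tri< e◁b _ _ = ℕₚ.<⇒≱ (time-smaller a◁e e◁b e<b ba) t≤ae
    ... | tri> _ _ b◁e with time-between ab b◁e e<b ba
    ...   | inj₁ (p , q) = ℕₚ.<-asym (waiting (e<b , b◁e) (ℕₚ.<⇒≤ (ℕₚ.<-trans p q))) eb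
    ...   | inj₂ (_ , q) = ℕₚ.<⇒≱ q t≤ae
    nothing-between {a} {b} {e} ((ba , ab) , refl) ae eb | tri> _ _ a<e | tri< e<b _ _ =
      ℕₚ.<-asym (ℕₚ.<-trans e<b ba) a<e
    nothing-between {a} {b} {e} ((ba , ab) , refl) ae eb | tri> _ _ a<e | tri> _ _ b<e
      with (_ , e◁b) , t≤eb ← pending b<e eb
      with ℕₚ.<-cmp (pos π a) (pos π e)
    ... | tri≈ _ p≡ _ = ℕₚ.<⇒≢ a<e (cong toℕ (pos-injective π complete p≡))
    ... | tri< a◁e _ _ = ℕₚ.<⇒≱ (time-larger a◁e e◁b ba a<e) t≤eb
    ... | tri> _ _ e◁a with time-between e◁a ab ba a<e
    ...   | inj₁ (_ , q) = ℕₚ.<⇒≱ q t≤eb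
    ...   | inj₂ (p , q) = ℕₚ.<-asym (waiting (a<e , e◁a) (ℕₚ.<⇒≤ (ℕₚ.<-trans p q))) ae

    crosses-adjacent : ∀ {a b} → Crosses t a b → pos w b ≡ suc (pos w a)
    crosses-adjacent {a} {b} c@((ba , ab) , refl) with ℕₚ.<-cmp (pos w b) (suc (pos w a))
    ... | tri≈ _ eq _ = eq
    ... | tri< lt _ _ = ⊥-elim (ℕₚ.<⇒≱ (waiting (ba , ab) ℕₚ.≤-refl) (ℕₚ.≤-pred lt))
    ... | tri> _ _ gt with e , eq ← element-at w present (ℕₚ.<-trans gt (present b)) =
      ⊥-elim (nothing-between c (ℕₚ.≤-reflexive (sym eq)) (subst (_< pos w b) (sym eq) gt))

    swaps : All (SwapsAt w) (swapPositions t w)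
    swaps = Allₚ.map⁺ (All.map swap (Allₚ.all-filter (rightMover? t) (allFin n)))
      where
      swap : ∀ {a} → ∃ (Crosses t a) → SwapsAt w (pos w a)
      swap {a} (b , c) = subst (_< n) (crosses-adjacent c) (present b) , a , b , refl , crosses-adjacent c

    -- If two right movers were neighbours, the second would be the partner of the first and would
    -- move both ways at once.
    swaps-farApart : AllPairs FarApart (swapPositions t w)
    swaps-farApart = AllPairsₚ.map⁺ (go (AllPairsₚ.filter⁺ (rightMover? t) (allFin⁺ n))
      (Allₚ.all-filter (rightMover? t) (allFin n)))
      where
      not-next : ∀ {a a'} → ∃ (Crosses t a) → ∃ (Crosses t a') → suc (pos w a) ≢ pos w a'
      not-next (b , c) (b' , c') eq with refl ← pos-injective w present (trans (crosses-adjacent c) eq) =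
        crosses-one-way c c'
      far : ∀ {a a'} → a ≢ a' → ∃ (Crosses t a) → ∃ (Crosses t a') → FarApart (pos w a) (pos w a')
      far {a} {a'} a≢a' c c' with ℕₚ.<-cmp (pos w a) (pos w a')
      ... | tri< lt _ _ = inj₁ (ℕₚ.≤∧≢⇒< lt (not-next c c'))
      ... | tri≈ _ eq _ = ⊥-elim (a≢a' (pos-injective w present eq))
      ... | tri> _ _ gt = inj₂ (ℕₚ.≤∧≢⇒< gt (not-next c' c))
      go : ∀ {xs} → AllPairs _≢_ xs → All (λ a → ∃ (Crosses t a)) xs →
        AllPairs (λ a a' → FarApart (pos w a) (pos w a')) xs
      go [] [] = []
      go (x≢ ∷ u) (c ∷ cs) = All.zipWith (λ (a≢a' , c') → far a≢a' c c') (x≢ , cs) ∷ go u cs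

    private
      w' = advance t w

      pos-advance : ∀ x → pos w' x ≡ transposes (swapPositions t w) (pos w x)
      pos-advance = pos-swaps w (swapPositions t w) swaps swaps-farApart

      listed : ∀ {a b} → Crosses t a b → pos w a ∈ swapPositions t w
      listed {a} {b} c = ∈-map⁺ (pos w) (∈-filter⁺ (rightMover? t) (∈-allFin a) (b , c))

    moves-right : ∀ {a b} → Crosses t a b → pos w' a ≡ suc (pos w a)
    moves-right {a} c = trans (pos-advance a) (proj₁ (transposes-∈ swaps-farApart (listed c)))

    moves-left : ∀ {a b} → Crosses t a b → pos w b ≡ suc (pos w' b)
    moves-left {a} {b} c = trans (crosses-adjacent c) (cong suc (sym (trans (pos-advance b)
      (trans (cong (transposes (swapPositions t w)) (crosses-adjacent c))
        (proj₂ (transposes-∈ swaps-farApart (listed c)))))))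

    stays : ∀ {x} → ¬ ∃ (Crosses t x) → ¬ ∃ (λ a → Crosses t a x) → pos w' x ≡ pos w x
    stays {x} ¬right ¬left = trans (pos-advance x) (transposes-fixed _
      (Allₚ.map⁺ (All.map fixed (Allₚ.all-filter (rightMover? t) (allFin n)))))
      where
      fixed : ∀ {a} → ∃ (Crosses t a) → pos w x ≢ pos w a × pos w x ≢ suc (pos w a)
      fixed {a} (b , c) =
        (λ eq → ¬right (b , subst (λ z → Crosses t z b) (sym (pos-injective w present eq)) c)) ,
        (λ eq → ¬left (a , subst (Crosses t a) (sym (pos-injective w present
          (trans eq (sym (crosses-adjacent c))))) c))

    data Motion (x : Fin n) : Set where
      rightward : ∀ {b} → Crosses t x b → pos w' x ≡ suc (pos w x) → Motion x
      leftward : ∀ {a} → Crosses t a x → pos w x ≡ suc (pos w' x) → Motion x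
      still : ¬ ∃ (Crosses t x) → ¬ ∃ (λ a → Crosses t a x) → pos w' x ≡ pos w x → Motion x

    motion : ∀ x → Motion x
    motion x with rightMover? t x | Finₚ.any? (λ a → crosses? t a x)
    ... | yes (_ , c) | _ = rightward c (moves-right c)
    ... | no _ | yes (_ , c) = leftward c (moves-left c)
    ... | no ¬r | no ¬l = still ¬r ¬l (stays ¬r ¬l)

    before-preserved : ∀ {x y} → ¬ Crosses t x y → Before w x y → Before w' x y
    before-preserved {x} {y} ¬c lt with motion x | motion y
    ... | rightward {b} c eq | my = after my
      where
      beyond : suc (pos w x) < pos w y
      beyond = ℕₚ.≤∧≢⇒< lt (λ eq' → ¬c (subst (Crosses t x)
        (pos-injective w present (trans (crosses-adjacent c) eq')) c))
      after : Motion y → Before w' x y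
      after (rightward _ eq') rewrite eq | eq' = ℕₚ.m<n⇒m<1+n beyond
      after (still _ _ eq') rewrite eq | eq' = beyond
      after (leftward {a} c' eq') rewrite eq =
        ℕₚ.≤∧≢⇒< (ℕₚ.≤-pred (subst (suc (pos w x) <_) eq' beyond)) clash
        where
        -- Otherwise a single element stands between `x` and `y`, and it is crossed by `x` while it
        -- crosses `y`.
        clash : suc (pos w x) ≢ pos w' y
        clash eq″ with refl ← pos-injective w present {b} {a} (trans (crosses-adjacent c)
          (trans eq″ (ℕₚ.suc-injective (trans (sym eq') (crosses-adjacent c'))))) = crosses-one-way c c'
    ... | leftward {a} c eq | my = after my
      where
      x'<x : pos w' x < pos w x
      x'<x = ℕₚ.≤-reflexive (sym eq)
      after : Motion y → Before w' x y
      after (rightward _ eq') rewrite eq' = ℕₚ.<-trans x'<x (ℕₚ.m<n⇒m<1+n lt)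
      after (still _ _ eq') rewrite eq' = ℕₚ.<-trans x'<x lt
      after (leftward _ eq') = ℕₚ.<-≤-trans x'<x (ℕₚ.≤-pred (subst (pos w x <_) eq' lt))
    ... | still ¬r _ eq | my = after my
      where
      after : Motion y → Before w' x y
      after (rightward _ eq') rewrite eq | eq' = ℕₚ.m<n⇒m<1+n lt
      after (still _ _ eq') rewrite eq | eq' = lt
      after (leftward {a} c' eq') rewrite eq = ℕₚ.≤∧≢⇒< (ℕₚ.≤-pred (subst (pos w x <_) eq' lt))
        (λ eq″ → ¬r (y , subst (λ z → Crosses t z y) (sym (pos-injective w present
          (trans eq″ (ℕₚ.suc-injective (trans (sym eq') (crosses-adjacent c')))))) c'))

    crossing-reversed : ∀ {a b} → Crosses t a b → Before w' b a
    crossing-reversed {a} {b} c = ℕₚ.≤-reflexive (trans (sym (moves-left c))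
      (trans (crosses-adjacent c) (sym (moves-right c))))

    complete' : Complete w'
    complete' x with motion x
    ... | rightward c eq = subst (_< n) (trans (crosses-adjacent c) (sym eq)) (present _)
    ... | leftward _ eq = ℕₚ.<-trans (ℕₚ.≤-reflexive (sym eq)) (present x)
    ... | still _ _ eq = subst (_< n) (sym eq) (present x)

    next : State (suc t) w'
    next = record
      { present = complete'
      ; pending = pending'
      ; waiting = λ inv lt → before-preserved (λ (_ , eq) → ℕₚ.<⇒≢ lt (sym eq)) (waiting inv (ℕₚ.<⇒≤ lt))
      }
      where
      pending' : ∀ {a b} → b Fin.< a → Before w' a b → Inv a b × suc t ≤ time a b
      pending' {a} {b} b<a lt with pos w a ℕ.<? pos w b
      -- A pair already in order cannot be put out of order, since only inversions cross.
      ... | no ¬ab = ⊥-elim (ℕₚ.<-asym lt (before-preserved (λ ((a<b , _) , _) → ℕₚ.<-asym a<b b<a)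
              (before-connex w present (λ { refl → ℕₚ.<-irrefl refl b<a }) ¬ab)))
      ... | yes ab with inv , t≤ ← pending b<a ab =
        inv , ℕₚ.≤∧≢⇒< t≤ (λ eq → ℕₚ.<-asym lt (crossing-reversed (inv , sym eq)))

    adjacent : Adjacent w w'
    adjacent = swapPositions t w , All.map proj₁ swaps , swaps-farApart , refl

  run : ℕ → Perm n
  run zero = π
  run (suc t) = advance t (run t)

  run-state : ∀ t → State t (run t)
  run-state zero = record
    { present = complete
    ; pending = λ b<a ab → (b<a , ab) , ℕ.z≤n
    ; waiting = λ (_ , ab) _ → ab
    }
  run-state (suc t) = Step.next (run-state t)

  run-finished : ∀ t → (∀ a b → time a b < t) → run t ≡ identity n
  run-finished t late = monotone⇒identity (run t) present
    (λ {x} {y} x<y → before-connex (run t) present (λ { refl → ℕₚ.<-irrefl refl x<y })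
      (λ yx → ℕₚ.<⇒≱ (late y x) (proj₂ (pending x<y yx))))
    where open State (run-state t)

  run-idle : ∀ t → (∀ a b → time a b ≢ t) → run (suc t) ≡ run t
  run-idle t idle = cong (λ xs → List.foldr swapAt (run t) (List.map (pos (run t)) xs))
    (Listₚ.filter-none (rightMover? t) (Allₚ.tabulate⁺ (λ a (b , _ , eq) → idle a b eq)))

-- Segments

dir-right : ∀ p → dir p (suc p) ≡ right
dir-right zero = refl
dir-right (suc p) = dir-right p

dir-left : ∀ p → dir (suc p) p ≡ left
dir-left zero = refl
dir-left (suc p) = dir-left p

dir-vert : ∀ p → dir p p ≡ vert
dir-vert zero = refl
dir-vert (suc p) = dir-vert p

arrow : LR → Dir
arrow L = left
arrow R = right

opposite : LR → LR
opposite L = R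
opposite R = L

classify : ∀ c d → d ≡ arrow c ⊎ d ≡ arrow (opposite c) ⊎ d ≡ vert
classify L left = inj₁ refl
classify L right = inj₂ (inj₁ refl)
classify R left = inj₂ (inj₁ refl)
classify R right = inj₁ refl
classify _ vert = inj₂ (inj₂ refl)

arrow≢vert : ∀ c → vert ≢ arrow c
arrow≢vert L ()
arrow≢vert R ()

arrow≢opposite : ∀ c → arrow c ≢ arrow (opposite c)
arrow≢opposite L ()
arrow≢opposite R ()

segments-same : ∀ c d ds → d ≡ arrow c →
  segments (just (arrow c)) (d ∷ ds) ≡ segments (just (arrow c)) ds
segments-same L _ ds refl = refl
segments-same R _ ds refl = refl

segments-vert : ∀ p d ds → d ≡ vert → segments (just p) (d ∷ ds) ≡ segments (just vert) ds
segments-vert left _ ds refl = refl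
segments-vert right _ ds refl = refl
segments-vert vert _ ds refl = refl

segments-new : ∀ c p d ds → d ≡ arrow c → p ≢ arrow c →
  segments (just p) (d ∷ ds) ≡ c ∷ segments (just (arrow c)) ds
segments-new L left _ ds refl h = ⊥-elim (h refl)
segments-new L right _ ds refl h = refl
segments-new L vert _ ds refl h = refl
segments-new R left _ ds refl h = refl
segments-new R right _ ds refl h = ⊥-elim (h refl)
segments-new R vert _ ds refl h = refl

-- Vertical steps emit no symbol, so a fictitious vertical step before time 0 changes nothing, and
-- the lemmas below may assume a previous direction.
segments-nothing : ∀ ds → segments nothing ds ≡ segments (just vert) ds
segments-nothing [] = refl
segments-nothing (left ∷ ds) = refl
segments-nothing (right ∷ ds) = refl
segments-nothing (vert ∷ ds) = refl

-- All occurrences of `c` form one block. The successor form is what the contiguity of crossing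
-- times provides, and it passes to tails.
Contiguous : LR → (ℕ → Dir) → Set
Contiguous c f = ∀ {s t} → s < t → f s ≡ arrow c → f t ≡ arrow c → f (suc s) ≡ arrow c

Occurs : LR → (ℕ → Dir) → ℕ → Set
Occurs c f n = ∃ λ t → t < n × f t ≡ arrow c

Absent : LR → (ℕ → Dir) → Set
Absent c f = ∀ t → f t ≢ arrow c

-- Every occurrence of c continues a segment that is under way just before time 0.
Continues : LR → (ℕ → Dir) → Set
Continues c f = ∀ t → f t ≡ arrow c → f 0 ≡ arrow c

Precedes : LR → LR → (ℕ → Dir) → Set
Precedes c d f = ∀ {s t} → f s ≡ arrow c → f t ≡ arrow d → s < t

contiguous-tail : ∀ {c f} → Contiguous c f → Contiguous c (f ∘ suc)
contiguous-tail contig s<t = contig (ℕ.s<s s<t)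

occurs-tail : ∀ {c f n} → f 0 ≢ arrow c → Occurs c f (suc n) → Occurs c (f ∘ suc) n
occurs-tail f0≢ (zero , _ , eq) = ⊥-elim (f0≢ eq)
occurs-tail f0≢ (suc t , ℕ.s<s t<n , eq) = t , t<n , eq

continues-tail : ∀ {c f} → Contiguous c f → f 0 ≡ arrow c → Continues c (f ∘ suc)
continues-tail contig f0≡ t eq = contig ℕ.z<s f0≡ eq

precedes-tail : ∀ {c d f} → Precedes c d f → Precedes c d (f ∘ suc)
precedes-tail prec p q = ℕ.s<s⁻¹ (prec p q)

run-segments : Dir → (ℕ → Dir) → ℕ → List LR
run-segments p f n = segments (just p) (applyUpTo f n)

no-segments : ∀ p f n → Absent L f → Absent R f → run-segments p f n ≡ []
no-segments p f zero _ _ = refl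
no-segments p f (suc n) ¬l ¬r with classify L (f 0)
... | inj₁ eq = ⊥-elim (¬l 0 eq)
... | inj₂ (inj₁ eq) = ⊥-elim (¬r 0 eq)
... | inj₂ (inj₂ eq) = trans (segments-vert p (f 0) (applyUpTo (f ∘ suc) n) eq)
  (no-segments vert (f ∘ suc) n (¬l ∘ suc) (¬r ∘ suc))

absent-both : ∀ c {f} → Absent c f → Absent (opposite c) f → ∀ p n → run-segments p f n ≡ []
absent-both L {f} ¬c ¬d p n = no-segments p f n ¬c ¬d
absent-both R {f} ¬c ¬d p n = no-segments p f n ¬d ¬c

-- While the direction is `c` the same segment goes on; at the first other step `Continues` rules
-- out any further `c`.
rest-of-segment : ∀ c f n → Continues c f → Contiguous c f → Absent (opposite c) f →
  run-segments (arrow c) f n ≡ []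
rest-of-segment c f zero _ _ _ = refl
rest-of-segment c f (suc n) cont contig ¬d with classify c (f 0)
... | inj₁ eq = trans (segments-same c (f 0) (applyUpTo (f ∘ suc) n) eq)
  (rest-of-segment c (f ∘ suc) n (continues-tail contig eq) (contiguous-tail contig) (¬d ∘ suc))
... | inj₂ (inj₁ eq) = ⊥-elim (¬d 0 eq)
... | inj₂ (inj₂ eq) = absent-both c (λ t e → arrow≢vert c (trans (sym eq) (cont t e))) ¬d (arrow c) (suc n)

one-segment : ∀ c p f n → p ≢ arrow c → Contiguous c f → Occurs c f n → Absent (opposite c) f →
  run-segments p f n ≡ c ∷ []
one-segment c p f zero _ _ (_ , () , _) _
one-segment c p f (suc n) p≢ contig occ ¬d with classify c (f 0)
... | inj₁ eq = trans (segments-new c p (f 0) (applyUpTo (f ∘ suc) n) eq p≢)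
  (cong (c ∷_) (rest-of-segment c (f ∘ suc) n (continues-tail contig eq) (contiguous-tail contig) (¬d ∘ suc)))
... | inj₂ (inj₁ eq) = ⊥-elim (¬d 0 eq)
... | inj₂ (inj₂ eq) = trans (segments-vert p (f 0) (applyUpTo (f ∘ suc) n) eq)
  (one-segment c vert (f ∘ suc) n (arrow≢vert c) (contiguous-tail contig)
    (occurs-tail (λ e → arrow≢vert c (trans (sym eq) e)) occ) (¬d ∘ suc))

opposite-involutive : ∀ c → opposite (opposite c) ≡ c
opposite-involutive L = refl
opposite-involutive R = refl

rest-then-segment : ∀ c f n → Continues c f → Contiguous c f → Contiguous (opposite c) f →
  Occurs (opposite c) f n → Precedes c (opposite c) f →
  run-segments (arrow c) f n ≡ opposite c ∷ []
rest-then-segment c f zero _ _ _ (_ , () , _) _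
rest-then-segment c f (suc n) cont contig contig' occ prec with classify c (f 0)
... | inj₁ eq = trans (segments-same c (f 0) (applyUpTo (f ∘ suc) n) eq)
  (rest-then-segment c (f ∘ suc) n (continues-tail contig eq) (contiguous-tail contig)
    (contiguous-tail contig') (occurs-tail (λ e → arrow≢opposite c (trans (sym eq) e)) occ)
    (precedes-tail prec))
-- The first segment is over and `c` does not recur, so only the block of the opposite direction
-- remains.
... | inj₂ f0 = one-segment (opposite c) (arrow c) f (suc n) (arrow≢opposite c) contig' occ
  (subst (λ d → Absent d f) (sym (opposite-involutive c)) (λ t e → f0≢ f0 (cont t e)))
  where
  f0≢ : f 0 ≡ arrow (opposite c) ⊎ f 0 ≡ vert → f 0 ≢ arrow c
  f0≢ (inj₁ x) e = arrow≢opposite c (trans (sym e) x)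
  f0≢ (inj₂ x) e = arrow≢vert c (trans (sym x) e)

two-segments : ∀ c p f n → p ≢ arrow c → Contiguous c f → Contiguous (opposite c) f →
  Occurs c f n → Occurs (opposite c) f n → Precedes c (opposite c) f →
  run-segments p f n ≡ c ∷ opposite c ∷ []
two-segments c p f zero _ _ _ (_ , () , _) _ _
two-segments c p f (suc n) p≢ contig contig' occ occ' prec with classify c (f 0)
... | inj₁ eq = trans (segments-new c p (f 0) (applyUpTo (f ∘ suc) n) eq p≢)
  (cong (c ∷_) (rest-then-segment c (f ∘ suc) n (continues-tail contig eq) (contiguous-tail contig)
    (contiguous-tail contig') (occurs-tail (λ e → arrow≢opposite c (trans (sym eq) e)) occ')
    (precedes-tail prec)))
-- Starting in the opposite direction would require an occurrence of `c` before time 0.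
... | inj₂ (inj₁ eq) with () ← prec (proj₂ (proj₂ occ)) eq
... | inj₂ (inj₂ eq) = trans (segments-vert p (f 0) (applyUpTo (f ∘ suc) n) eq)
  (two-segments c vert (f ∘ suc) n (arrow≢vert c) (contiguous-tail contig) (contiguous-tail contig')
    (occurs-tail (λ e → arrow≢vert c (trans (sym eq) e)) occ)
    (occurs-tail (λ e → arrow≢vert (opposite c) (trans (sym eq) e)) occ') (precedes-tail prec))

length-filterᵇ-≤1 : (g : ℕ → Bool) → (∀ {s t} → g s ≡ true → g t ≡ true → s ≡ t) →
  ∀ n → length (filterᵇ g (upTo n)) ≤ 1
length-filterᵇ-≤1 g unique n =
  at-most-one (AllPairsₚ.filter⁺ (T? ∘ g) (upTo⁺ n)) (Allₚ.all-filter (T? ∘ g) (upTo n))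
  where
  at-most-one : ∀ {ts} → AllPairs _≢_ ts → All (T ∘ g) ts → length ts ≤ 1
  at-most-one [] _ = ℕ.z≤n
  at-most-one ([] ∷ _) _ = ℕ.s≤s ℕ.z≤n
  at-most-one ((s≢t ∷ _) ∷ _) (gs ∷ gt ∷ _) =
    ⊥-elim (s≢t (unique (Equivalence.to T-≡ gs) (Equivalence.to T-≡ gt)))

xor-true : {A B : Set} (A? : Dec A) (B? : Dec B) → does A? xor does B? ≡ true → (A × ¬ B) ⊎ (¬ A × B)
xor-true (yes a) (no ¬b) _ = inj₁ (a , ¬b)
xor-true (no ¬a) (yes b) _ = inj₂ (¬a , b)

bounded : ∀ {n} (f : Fin n → ℕ) → ∃ λ k → ∀ i → f i < k
bounded {zero} f = 0 , λ ()
bounded {suc n} f with k , h ← bounded (f ∘ suc) = suc (f zero) ⊔ k , λ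
  { zero → ℕₚ.m≤m⊔n (suc (f zero)) k
  ; (suc i) → ℕₚ.<-≤-trans (h i) (ℕₚ.m≤n⊔m (suc (f zero)) k) }

bounded₂ : ∀ {m n} (f : Fin m → Fin n → ℕ) → ∃ λ k → ∀ i j → f i j < k
bounded₂ f with k , h ← bounded (λ i → proj₁ (bounded (f i))) =
  k , λ i j → ℕₚ.<-trans (proj₂ (bounded (f i)) j) (h i)

-- From a balanced and aligned marking to crossing times

module Alignment {n : ℕ} (π : Perm n) (isPerm : IsPerm π) (M : Marking n)
  (isMarking : IsMarkingFor π M) (balancedM : BalancedMarking π M) (aligned : AlignedMarking π M) where

  complete : Complete π
  complete = isPerm⇒complete π isPerm

  before-cmp : Trichotomous _≡_ (Before π)
  before-cmp a b with ℕₚ.<-cmp (pos π a) (pos π b)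
  ... | tri< p ¬q ¬r = tri< p (λ { refl → ¬q refl }) ¬r
  ... | tri≈ ¬p q ¬r = tri≈ ¬p (pos-injective π complete q) ¬r
  ... | tri> ¬p ¬q r = tri> ¬p (λ { refl → ¬q refl }) r

  RL? : ∀ e → Dec (M e ≡ R ∷ L ∷ [])
  RL? e = Listₚ.≡-dec _≟LR_ (M e) (R ∷ L ∷ [])

  -- Elements that are not switchbacks also receive `false`; `¬rl⇒LR` recovers the letter string
  -- where inversions on both sides make `e` a switchback.
  rl : Fin n → Bool
  rl e = does (RL? e)

  rl-true : ∀ {e} → rl e ≡ true → M e ≡ R ∷ L ∷ []
  rl-true {e} eq with RL? e
  ... | yes p = p

  rl-false : ∀ {e} → rl e ≡ false → M e ≢ R ∷ L ∷ []
  rl-false {e} eq with RL? e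
  ... | no ¬p = ¬p

  RL⇒rl : ∀ {e} → M e ≡ R ∷ L ∷ [] → rl e ≡ true
  RL⇒rl {e} = dec-true (RL? e)

  LR⇒¬rl : ∀ {e} → M e ≡ L ∷ R ∷ [] → rl e ≡ false
  LR⇒¬rl {e} eq = dec-false (RL? e) (λ eq' → LR≢RL (trans (sym eq) eq'))
    where
    LR≢RL : L ∷ R ∷ [] ≢ R ∷ L ∷ []
    LR≢RL ()

  switchback : ∀ {a e b} → Inversion π a e → Inversion π e b → M e ≡ L ∷ R ∷ [] ⊎ M e ≡ R ∷ L ∷ []
  switchback {e = e} ae eb = proj₁ (proj₂ (proj₂ (isMarking e))) (_ , ae) (_ , eb)

  ¬rl⇒LR : ∀ {a e b} → Inversion π a e → Inversion π e b → rl e ≡ false → M e ≡ L ∷ R ∷ []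
  ¬rl⇒LR ae eb r with switchback ae eb
  ... | inj₁ p = p
  ... | inj₂ p = ⊥-elim (rl-false r p)

  ◁-trans : ∀ {a b c} → Before π a b → Before π b c → Before π a c
  ◁-trans = ℕₚ.<-trans

  module X = Crossings ◁-trans before-cmp Finₚ.<-trans Finₚ.<-cmp rl
  open X using (LeftSB; RightSB; Rec; Unobstructed; Balanced)

  leftSB⇒ : ∀ {a b c d e} → LeftSB a b c d e → LeftSwitchback π M a b c d e
  leftSB⇒ (r , rest) = rl-true r , rest

  leftSB⇐ : ∀ {a b c d e} → LeftSwitchback π M a b c d e → LeftSB a b c d e
  leftSB⇐ (r , rest) = RL⇒rl r , rest

  -- Inside a rec `e` is a genuine switchback: the larger of `a` and `b` crosses it, and it crosses
  -- `d`.
  rightSB⇒ : ∀ {a b c d e} → Rec a b c d → RightSB a b c d e → RightSwitchback π M a b c d e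
  rightSB⇒ (ab , bc , cd , ca , cb , da , db) (r , ce , ed , inj₁ (ae , eb)) =
    ¬rl⇒LR (eb , ◁-trans bc ce) (ℕₚ.<-trans da ae , ed) r , ce , ed , inj₁ (ae , eb)
  rightSB⇒ (ab , bc , cd , ca , cb , da , db) (r , ce , ed , inj₂ (be , ea)) =
    ¬rl⇒LR (ea , ◁-trans ab (◁-trans bc ce)) (ℕₚ.<-trans db be , ed) r , ce , ed , inj₂ (be , ea)

  rightSB⇐ : ∀ {a b c d e} → RightSwitchback π M a b c d e → RightSB a b c d e
  rightSB⇐ (r , rest) = LR⇒¬rl r , rest

  balanced : Balanced
  balanced a b c d rec with regular , irregular ← balancedM a b c d rec =
    (λ reg P? Q? → trans (countFin-cong P? (leftSwitchback? π M a b c d) (λ _ → leftSB⇒) (λ _ → leftSB⇐))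
      (trans (regular reg) (countFin-cong (rightSwitchback? π M a b c d) Q?
        (λ _ → rightSB⇐) (λ _ → rightSB⇒ rec)))) ,
    λ ¬reg e → proj₁ (irregular ¬reg e) ∘ leftSB⇒ , proj₂ (irregular ¬reg e) ∘ rightSB⇒ rec

  -- Induction on the gap between a and b: alignment excludes gap one, and an
  -- element strictly between them in position either gives a non-empty
  -- irregular rec or replaces a or b.
  unobstructed : Unobstructed
  unobstructed {a = a} {b = b} da ab bc ca a<b bd =
    go (pos π b) da ab (ℕₚ.m≤m+n (pos π b) (pos π a)) bc ca a<b bd
    where
    go : ∀ gap {d a b c} → Before π d a → Before π a b → pos π b ≤ gap + pos π a → Before π b c →
      c Fin.< a → a Fin.< b → b Fin.< d → rl a ≡ true → rl b ≡ false → ⊥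
    go zero da ab near bc ca a<b bd ra rb = ℕₚ.<⇒≱ ab near
    go (suc gap) {d} {a} {b} {c} da ab near bc ca a<b bd ra rb
      with pos π b ℕ.≟ suc (pos π a)
    ... | yes next = ℕₚ.<-asym a<b (proj₁ (aligned a b next
            (cong List.head (rl-true ra))
            (cong List.head (¬rl⇒LR (bd , ◁-trans da ab) (ℕₚ.<-trans ca a<b , bc) rb))))
    ... | no ¬next
      with e , next ← element-at π complete (ℕₚ.<-trans (ℕₚ.≤∧≢⇒< ab (¬next ∘ sym)) (complete b))
      = between (Finₚ.<-cmp e a) (Finₚ.<-cmp e b)
      where
      ae : Before π a e
      ae = ℕₚ.≤-reflexive (sym next)
      eb : Before π e b
      eb = subst (_< pos π b) (sym next) (ℕₚ.≤∧≢⇒< ab (¬next ∘ sym))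
      between : _ → _ → ⊥
      between (tri≈ _ refl _) _ = ℕₚ.<-irrefl refl ae
      between _ (tri≈ _ refl _) = ℕₚ.<-irrefl refl eb
      between (tri< e<a _ _) _ =
        proj₂ (proj₂ (balanced d a e c (da , ae , ◁-trans eb bc , ℕₚ.<-trans e<a a<d , e<a , c<d , ca))
          (λ (d<a , _) → ℕₚ.<-asym d<a a<d) b) (rb , eb , bc , inj₂ (a<b , bd))
        where
        a<d = ℕₚ.<-trans a<b bd
        c<d = ℕₚ.<-trans ca a<d
      between (tri> _ _ _) (tri> _ _ b<e) =
        proj₁ (proj₂ (balanced d e b c (◁-trans da ae , eb , bc , bd , b<e ,
            ℕₚ.<-trans c<b bd , ℕₚ.<-trans c<b b<e))
          (λ (_ , b<c) → ℕₚ.<-asym b<c c<b) a) (ra , da , ae , inj₂ (ca , a<b))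
        where c<b = ℕₚ.<-trans ca a<b
      between (tri> _ _ a<e) (tri< e<b _ _) with rl e in re
      ... | true = go gap (◁-trans da ae) eb
              (ℕₚ.≤-trans near (ℕₚ.≤-reflexive
                (trans (sym (ℕₚ.+-suc gap (pos π a))) (cong (gap +_) (sym next)))))
              bc (ℕₚ.<-trans ca a<e) e<b bd re rb
      ... | false = go gap da ae
              (ℕₚ.≤-pred (ℕₚ.≤-trans eb near))
              (◁-trans eb bc) ca a<e (ℕₚ.<-trans e<b bd) ra re

  open Schedule {_◁_ = Before π} {_<_ = Fin._<_}
    ◁-trans before-cmp Finₚ.<-trans Finₚ.<-cmp rl n (pos π) complete id

  crossingTimes : CrossingTimes π rl
  crossingTimes = record
    { time = time unobstructed balanced
    ; time-positive = λ _ _ ()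
    ; time-smaller = time-smaller unobstructed balanced
    ; time-larger = time-larger unobstructed balanced
    ; time-LR = time-LR unobstructed balanced
    ; time-RL = time-RL unobstructed balanced
    ; time-contiguousʳ = time-contiguousʳ unobstructed balanced
    ; time-contiguousˡ = time-contiguousˡ unobstructed balanced
    }

-- The tangle of a schedule and its marking

module Drawing {n : ℕ} (π : Perm n) (complete : Complete π) (M : Marking n)
  (isMarking : IsMarkingFor π M) (rl : Fin n → Bool)
  (LR⇒¬rl : ∀ {e} → M e ≡ L ∷ R ∷ [] → rl e ≡ false)
  (RL⇒rl : ∀ {e} → M e ≡ R ∷ L ∷ [] → rl e ≡ true)
  (times : CrossingTimes π rl) where

  open CrossingTimes times
  open Execution π complete rl times

  end : ℕ
  end = proj₁ (bounded₂ time)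

  before-end : ∀ a b → time a b < end
  before-end = proj₂ (bounded₂ time)

  -- `end` exceeds every crossing time, so `run end` is already sorted and the one extra step is
  -- idle, as the convention on the last two permutations asks.
  τ : Tangle n
  τ = tangle (suc end) run

  solves : Solves τ π
  solves = (λ t _ → inj₁ (Step.adjacent (run-state t))) , ℕ.s≤s ℕ.z≤n , refl , finished ,
    sym (run-idle 0 time-positive) , trans (run-finished end before-end) (sym finished)
    where
    finished : run (suc end) ≡ identity n
    finished = run-finished (suc end) (λ a b → ℕₚ.<-trans (before-end a b) (ℕₚ.n<1+n end))

  flip⇒crosses : ∀ t x y →
    (pos (run t) x ℕ.<ᵇ pos (run t) y) xor (pos (run (suc t)) x ℕ.<ᵇ pos (run (suc t)) y) ≡ true →
    Crosses t x y ⊎ Crosses t y x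
  flip⇒crosses t x y eq
    with xor-true (pos (run t) x ℕ.<? pos (run t) y) (pos (run (suc t)) x ℕ.<? pos (run (suc t)) y) eq
       | crosses? t x y | crosses? t y x
  ... | _ | yes c | _ = inj₁ c
  ... | _ | no _ | yes c = inj₂ c
  ... | inj₁ (p , ¬q) | no ¬c | no _ = ⊥-elim (¬q (Step.before-preserved (run-state t) ¬c p))
  ... | inj₂ (¬p , q) | no _ | no ¬c = ⊥-elim (ℕₚ.<-asym q (Step.before-preserved (run-state t) ¬c
    (before-connex (run t) (State.present (run-state t)) (λ { refl → ℕₚ.<-irrefl refl q }) ¬p)))

  simple : Simple τ
  simple x y = length-filterᵇ-≤1 _
    (λ {s} {t} p q → unique (flip⇒crosses s x y p) (flip⇒crosses t x y q)) (suc end)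
    where
    unique : ∀ {s t} → Crosses s x y ⊎ Crosses s y x → Crosses t x y ⊎ Crosses t y x → s ≡ t
    unique (inj₁ (_ , refl)) (inj₁ (_ , refl)) = refl
    unique (inj₂ (_ , refl)) (inj₂ (_ , refl)) = refl
    unique (inj₁ ((_ , p) , _)) (inj₂ ((_ , q) , _)) = ⊥-elim (ℕₚ.<-asym p q)
    unique (inj₂ ((_ , p) , _)) (inj₁ ((_ , q) , _)) = ⊥-elim (ℕₚ.<-asym p q)

  module Path (x : Fin n) where

    direction : ℕ → Dir
    direction t = dir (pos (run t) x) (pos (run (suc t)) x)

    crosses⇒right : ∀ {t b} → Crosses t x b → direction t ≡ right
    crosses⇒right {t} c =
      trans (cong (dir (pos (run t) x)) (Step.moves-right (run-state t) c))
        (dir-right (pos (run t) x))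

    crosses⇒left : ∀ {t a} → Crosses t a x → direction t ≡ left
    crosses⇒left {t} c =
      trans (cong (λ p → dir p (pos (run (suc t)) x)) (Step.moves-left (run-state t) c))
        (dir-left (pos (run (suc t)) x))

    right⇒crosses : ∀ {t} → direction t ≡ right → ∃ (Crosses t x)
    right⇒crosses {t} eq with Step.motion (run-state t) x
    ... | Step.rightward c _ = _ , c
    ... | Step.leftward c _ with () ← trans (sym eq) (crosses⇒left c)
    right⇒crosses {t} eq | Step.still _ _ eq'
      with () ← trans (sym eq) (trans (cong (dir (pos (run t) x)) eq') (dir-vert (pos (run t) x)))

    left⇒crosses : ∀ {t} → direction t ≡ left → ∃ λ a → Crosses t a x
    left⇒crosses {t} eq with Step.motion (run-state t) x
    ... | Step.leftward c _ = _ , c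
    ... | Step.rightward c _ with () ← trans (sym eq) (crosses⇒right c)
    left⇒crosses {t} eq | Step.still _ _ eq'
      with () ← trans (sym eq) (trans (cong (dir (pos (run t) x)) eq') (dir-vert (pos (run t) x)))

    contiguous : ∀ c → Contiguous c direction
    contiguous R {s} {t} s<t p q
      with b , ib , refl ← right⇒crosses {s} p
      with d , id , refl ← right⇒crosses {t} q
      with g , ig , eq ← time-contiguousʳ ib id s<t = crosses⇒right (ig , eq)
    contiguous L {s} {t} s<t p q
      with b , ib , refl ← left⇒crosses {s} p
      with d , id , refl ← left⇒crosses {t} q
      with g , ig , eq ← time-contiguousˡ ib id s<t = crosses⇒left (ig , eq)

    occurs-R : IsRight π x → Occurs R direction (suc end)
    occurs-R (b , ib) = time x b , ℕₚ.<-trans (before-end x b) (ℕₚ.n<1+n end) , crosses⇒right (ib , refl)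

    occurs-L : IsLeft π x → Occurs L direction (suc end)
    occurs-L (a , ia) = time a x , ℕₚ.<-trans (before-end a x) (ℕₚ.n<1+n end) , crosses⇒left (ia , refl)

    absent-R : ¬ IsRight π x → Absent R direction
    absent-R ¬r t eq with b , ib , _ ← right⇒crosses {t} eq = ¬r (b , ib)

    absent-L : ¬ IsLeft π x → Absent L direction
    absent-L ¬l t eq with a , ia , _ ← left⇒crosses {t} eq = ¬l (a , ia)

    precedes-LR : rl x ≡ false → Precedes L R direction
    precedes-LR r {s} {t} p q
      with a , (xa , ax) , refl ← left⇒crosses {s} p
      with b , (bx , xb) , refl ← right⇒crosses {t} q =
      let lt , lt' = time-LR ax xb bx xa r in ℕₚ.<-trans lt lt'

    precedes-RL : rl x ≡ true → Precedes R L direction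
    precedes-RL r {s} {t} p q
      with b , (bx , xb) , refl ← right⇒crosses {s} p
      with a , (xa , ax) , refl ← left⇒crosses {t} q =
      let lt , lt' = time-RL ax xb bx xa r in ℕₚ.<-trans lt lt'

    traced : run-segments vert direction (suc end) ≡ M x
    traced with isMarking x
              | Finₚ.any? (λ a → (x Fin.<? a) ×-dec (pos π a ℕ.<? pos π x))
              | Finₚ.any? (λ b → (b Fin.<? x) ×-dec (pos π x ℕ.<? pos π b))
    ... | _ , _ , _ , m | no ¬l | no ¬r =
      trans (no-segments vert direction (suc end) (absent-L ¬l) (absent-R ¬r)) (sym (m ¬l ¬r))
    ... | m , _ | yes l | no ¬r =
      trans (one-segment L vert direction (suc end) (λ ()) (contiguous L)
        (occurs-L l) (absent-R ¬r)) (sym (m l ¬r))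
    ... | _ , m , _ | no ¬l | yes r =
      trans (one-segment R vert direction (suc end) (λ ()) (contiguous R)
        (occurs-R r) (absent-L ¬l)) (sym (m r ¬l))
    ... | _ , _ , m , _ | yes l | yes r with m l r
    ...   | inj₁ eq = trans (two-segments L vert direction (suc end) (λ ()) (contiguous L) (contiguous R)
              (occurs-L l) (occurs-R r) (precedes-LR (LR⇒¬rl eq))) (sym eq)
    ...   | inj₂ eq = trans (two-segments R vert direction (suc end) (λ ()) (contiguous R) (contiguous L)
              (occurs-R r) (occurs-L l) (precedes-RL (RL⇒rl eq))) (sym eq)

    marking : tangleMarking τ x ≡ M x
    marking = trans (segments-nothing (steps τ x))
      (trans (cong (segments (just vert)) (Listₚ.map-upTo direction (suc end))) traced)

  -- Once the traced marking is known to be `M`, the bound on segments can be read off from the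
  -- strings that `IsMarkingFor` admits.
  few-letters : ∀ x → countLR L (M x) ≤ 1 × countLR R (M x) ≤ 1
  few-letters x with isMarking x
            | Finₚ.any? (λ a → (x Fin.<? a) ×-dec (pos π a ℕ.<? pos π x))
            | Finₚ.any? (λ b → (b Fin.<? x) ×-dec (pos π x ℕ.<? pos π b))
  ... | _ , _ , _ , m | no ¬l | no ¬r rewrite m ¬l ¬r = ℕ.z≤n , ℕ.z≤n
  ... | m , _ | yes l | no ¬r rewrite m l ¬r = ℕₚ.≤-refl , ℕ.z≤n
  ... | _ , m , _ | no ¬l | yes r rewrite m r ¬l = ℕ.z≤n , ℕₚ.≤-refl
  ... | _ , _ , m , _ | yes l | yes r with m l r
  ...   | inj₁ eq rewrite eq = ℕₚ.≤-refl , ℕₚ.≤-refl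
  ...   | inj₂ eq rewrite eq = ℕₚ.≤-refl , ℕₚ.≤-refl

  perfect : Perfect τ
  perfect = simple , λ x →
    subst (λ s → countLR L s ≤ 1 × countLR R s ≤ 1) (sym (Path.marking x)) (few-letters x)

theorem4 : (n : ℕ) (π : Perm n) → IsPerm π → (M : Marking n) →
    IsMarkingFor π M → BalancedMarking π M → AlignedMarking π M →
    Σ (Tangle n) λ τ → Solves τ π × Perfect τ × ((x : Fin n) → tangleMarking τ x ≡ M x)
theorem4 n π isPerm M isMarking balanced aligned = τ , solves , perfect , Path.marking
  where
  open Alignment π isPerm M isMarking balanced aligned
  open Drawing π complete M isMarking rl LR⇒¬rl RL⇒rl crossingTimes
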